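{- Let $\sigma(n)=\sum_{d\mid n} d$ be the sum-of-divisors function. The following three statements hold. (1) Let $k\ge 2$ be an integer, let $a_1,\dots,a_k$ be positive integers, and let $b_1,\dots,b_k$ be integers such that $a_ib_j\ne a_jb_i$ for every $1\le i<j\le k$. Then for any positive constant $C$, the set of positive integers $n$ for which \[ \frac{\sigma(a_1n+b_1)}{\sigma(a_2n+b_2)} > C, \quad \frac{\sigma(a_2n+b_2)}{\sigma(a_3n+b_3)} > C, \quad\dots,\quad \frac{\sigma(a_{k-1}n+b_{k-1})}{\sigma(a_kn+b_k)} > C \] all hold has positive lower density. In particular, the set of positive integers $n$ for which \[ \sigma(a_1n+b_1) > \sigma(a_2n+b_2) > \dots > \sigma(a_kn+b_k) \] has positive lower density. (2) Let $k\ge 2$ be an integer and let $\varepsilon_1,\dots,\varepsilon_{k-1}\in\{ -1,1\}$. Then the set of positive integers $n$ for which \[ \varepsilon_1(\sigma(n+1)-\sigma(n+2)) > 0,\quad \varepsilon_2(\sigma(n+2)-\sigma(n+3)) > 0,\quad \dots,\quad \varepsilon_{k-1}(\sigma(n+k-1)-\sigma(n+k)) > 0 \] all hold has positive lower density. (3) Let $a$ and $c$ be positive integers and let $b$ and $d$ be any integers such that $ad\ne bc$. Then for any positive integer $k$, the set of positive integers $n$ for which \[ \sigma\big(a(n+1)+b\big) > \sigma\big(c(n+1)+d\big),\quad \sigma\big(a(n+2)+b\big) > \sigma\big(c(n+2)+d\big),\quad \dots,\quad \sigma\big(a(n+k)+b\big) > \sigma\big(c(n+k)+d\big) \] all hold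 has positive lower density.
   Context: The lower density of a set $S$ of positive integers is $\liminf_{x\to\infty} \frac1x\#\{n\in S: n\le x\}$. Only those $n$ for which all arguments of $\sigma$ are positive are considered; this excludes only finitely many $n$ and does not affect lower density. -}

module Defs where

open import Data.Fin.Base using (Fin; toℕ)
open import Data.Fin.Subset using (Subset; _∈_; ∣_∣)
open import Data.Integer.Base as ℤ using (ℤ; +_; +[1+_]; 0ℤ)
open import Data.List.Base using (List; applyUpTo; filter)
open import Data.List.Properties using (filter-accept)
open import Data.Nat.Base as ℕ using (ℕ; suc)
open import Data.Nat.Divisibility using (_∣?_; 1∣_)
open import Data.Nat.ListAction using (sum)
open import Data.Product.Base using (∃-syntax; _×_)
open import Data.Rational.Base as ℚ using (ℚ; 0ℚ; _/_)
open import Level using (Level)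
open import Relation.Binary.PropositionalEquality using (cong; sym; subst)
open import Relation.Unary using (Pred)

private
  variable
    ℓ : Level

divisors : ℕ → List ℕ
divisors n = filter (_∣? n) (applyUpTo suc n)

-- σ 0 = 0 is a dummy value.
σ : ℕ → ℕ
σ n = sum (divisors n)

σ-nonZero : ∀ {z} → 0ℤ ℤ.< z → ℕ.NonZero (σ ℤ.∣ z ∣)
σ-nonZero {+ ℕ.zero} (ℤ.+<+ ())
σ-nonZero {+[1+ m ]} _ =
  subst ℕ.NonZero
    (sym (cong sum (filter-accept (_∣? suc m) {xs = applyUpTo (λ i → suc (suc i)) m} (1∣ suc m))))
    _

-- The quotient σ(y) / σ(z), for positive integers y and z.
σ-ratio : ∀ {y z} → 0ℤ ℤ.< y → 0ℤ ℤ.< z → ℚ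
σ-ratio {y} {z} _ z>0 = _/_ (+ σ ℤ.∣ y ∣) (σ ℤ.∣ z ∣) {{σ-nonZero z>0}}

affine : ℕ → ℤ → ℕ → ℤ
affine a b n = + a ℤ.* + n ℤ.+ b

-- Real numbers as Bishop's regular sequences: the n-th term is within
-- 1/(n+1) of the real number represented.
record ℝ : Set where
  field
    seq     : ℕ → ℚ
    regular : ∀ m n → ℚ.∣ seq m ℚ.- seq n ∣ ℚ.≤ + 1 / suc m ℚ.+ + 1 / suc n

open ℝ public

infix 4 _<ℝℚ_ _ℚ<ℝ_

_<ℝℚ_ : ℝ → ℚ → Set
c <ℝℚ q = ∃[ n ] seq c n ℚ.+ + 1 / suc n ℚ.< q

_ℚ<ℝ_ : ℚ → ℝ → Set
q ℚ<ℝ c = ∃[ n ] q ℚ.+ + 1 / suc n ℚ.< seq c n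

-- AtLeast r S x  says  r ≤ (1/x) #{ n ∈ S : 1 ≤ n ≤ x }  for a set S that need
-- not be decidable: a finite part of S ∩ {1,…,x} is exhibited whose size is at
-- least r x. The element i of Fin x stands for the positive integer i + 1.
AtLeast : ℚ → Pred ℕ ℓ → (x : ℕ) → .{{ℕ.NonZero x}} → Set ℓ
AtLeast r S x =
  ∃[ p ] (∀ {i : Fin x} → i ∈ p → S (suc (toℕ i))) × r ℚ.≤ + ∣ p ∣ / x

-- The lower density, a limit inferior, is given as a lower cut:
-- q < liminf f  iff some r > q satisfies r ≤ f x for all sufficiently large x.
infix 4 _<lowerDensity_

_<lowerDensity_ : ℚ → Pred ℕ ℓ → Set ℓ
q <lowerDensity S =
  ∃[ r ] q ℚ.< r × ∃[ N ] (∀ x → .{{_ : ℕ.NonZero x}} → N ℕ.≤ x → AtLeast r S x)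

PositiveLowerDensity : Pred ℕ ℓ → Set ℓ
PositiveLowerDensity S = 0ℚ <lowerDensity S

{-# OPTIONS --safe #-}
module Submission where

-- All three parts are instances of ranked-σ: given pairwise non-proportional
-- linear forms a_i n + b_i with distinct ranks, and given K, the set of n at
-- which every form of higher rank has a value of σ more than K times that of
-- every form of lower rank has positive lower density.
--
-- Write h(m) = σ(m) / m. The idea is to make the i-th form divisible by a number
-- q_i with h(q_i) as large as its rank demands, and to show that usually
-- nothing else contributes more than a bounded factor. The q_i are pairwise
-- coprime, and coprime to a number D that is divisible by all the a_i and all
-- the determinants a_i b_j - a_j b_i (abundantSequence). No primes are needed to
-- find them: the product of the numbers 1 + E j for j < J is coprime to E and
-- has the sum of their reciprocals as a lower bound for h, and that sum diverges
-- (abundant). The Chinese remainder theorem yields a residue class n = s + M t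
-- modulo the product M of the q_i on which q_i divides the i-th form, say with
-- cofactor m_i(t).
--
-- On this class h of the i-th form is at least h(q_i). Conversely σ(q m) is at
-- most σ(q) σ(m) (σ-*-≤), and the mean of h(m_i(t)) is bounded in terms of a_i
-- alone (mean-σ): as the determinants are coprime to the q_j, a common divisor d
-- of m_i(t) and m_i(u) divides a_i (u - t), so at most a_i T / d + 1 of the
-- t < T have d dividing m_i(t), and the series of a_i / d² converges. By Markov's
-- inequality and a union bound, for at least half of the t in [T, 2T) every
-- σ(m_i(t)) is at most a constant times m_i(t), with a constant that is known
-- before the q_i are chosen (many-good).
--
-- The first part ranks the forms in descending order. The second ranks each of
-- n + 1, n + 2, ... above or below all its predecessors, according to the sign.
-- For the third, if a c does not divide a d - b c, then none of the a (n + i) + b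
-- is proportional to any of the c (n + j) + d, and all the former are ranked above
-- all the latter. Otherwise a d - b c = a c z with z ≠ 0; then a (c x + d) is
-- c (a (x + z) + b), so that σ(c x + d) ≤ σ(c) σ(a (x + z) + b), and it suffices
-- that σ falls (if z > 0) or rises (if z < 0) by factors above σ(c) along the
-- values of a x + b at consecutive x.

open import Data.Bool.Base using (Bool; true; false; if_then_else_)
open import Data.Fin.Base using (Fin; toℕ; fromℕ<; inject₁; join; punchIn; splitAt; zero; suc; _↑ˡ_; _↑ʳ_) renaming (_<_ to _<ᶠ_)
open import Data.Fin.Properties using (all?; any?; join-splitAt; punchInᵢ≢i; splitAt-↑ˡ; splitAt-↑ʳ; toℕ-fromℕ<; toℕ-inject₁; toℕ-injective; toℕ<n) renaming (<-cmp to <ᶠ-cmp)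
open import Data.Fin.Subset using (Subset; ∣_∣) renaming (_∈_ to _∈ₛ_)
open import Data.Integer.Base as ℤ using (ℤ; +_; -[1+_]; 0ℤ; 1ℤ; -1ℤ; +<+; +≤+)
import Data.Integer.Divisibility.Signed as ℤ∣
import Data.Integer.Properties as ℤₚ
import Data.Integer.Tactic.RingSolver as ℤ-Solver
open import Data.List.Base using (List; []; _∷_; _++_; applyUpTo; cartesianProductWith; map)
open import Data.List.Membership.Propositional using (_∈_)
open import Data.List.Membership.Propositional.Properties using (∈-++⁺ˡ; ∈-++⁺ʳ; ∈-++⁻; ∈-applyUpTo⁺; ∈-applyUpTo⁻; ∈-cartesianProductWith⁺; ∈-filter⁺; ∈-filter⁻; ∈-map⁻; ∈-∃++)
open import Data.List.Relation.Binary.Subset.Propositional using (_⊆_)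
open import Data.List.Relation.Unary.All as All using ()
open import Data.List.Relation.Unary.All.Properties using (applyUpTo⁺₂)
open import Data.List.Relation.Unary.AllPairs using (_∷_; [])
open import Data.List.Relation.Unary.Any using (here; there)
open import Data.List.Relation.Unary.Unique.Propositional using (Unique)
import Data.List.Relation.Unary.Unique.Propositional.Properties as Unique
open import Data.Nat.Base as ℕ using (ℕ; zero; suc; _+_; _*_; _∸_; _^_; _/_; _%_; _!; _≤_; _<_; _>_; NonZero; z≤n; s≤s; z<s; s<s)
open import Data.Nat.Coprimality as Coprime using (Coprime; coprime-Bézout; coprime-divisor)
open import Data.Nat.Divisibility
open import Data.Nat.DivMod using (+-distrib-/-∣ʳ; /-mono-≤; /-monoˡ-≤; m%n<n; m*n/n≡m; m/n*n≡m; m/n*n≤m; m/n≤m; m≡m%n+[m/n]*n; n/n≡1)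
open import Data.Nat.GCD using (gcd; gcd[m,n]∣m; gcd[m,n]∣n; gcd[m,n]≢0; gcd-greatest; c*gcd[m,n]≡gcd[cm,cn]; module Bézout)
open import Data.Nat.ListAction using (product; sum)
open import Data.Nat.ListAction.Properties using (product≢0; sum-++; ∈⇒∣product)
open import Data.Nat.Properties
open import Data.Nat.Tactic.RingSolver using (solve-∀)
open import Data.Product.Base using (Σ-syntax; ∃-syntax; _×_; _,_; proj₁; proj₂)
open import Data.Rational.Base as ℚ using (ℚ; 0ℚ)
import Data.Rational.Properties as ℚₚ
import Data.Rational.Unnormalised.Base as ℚᵘ
import Data.Rational.Unnormalised.Properties as ℚᵘₚ
open import Data.Sum.Base using (_⊎_; inj₁; inj₂; [_,_]′)
open import Data.Unit.Base using (tt)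
open import Data.Vec.Base using (tabulate)
open import Data.Vec.Properties using ([]=⇒lookup; lookup∘tabulate)
open import Function.Base using (_∘_; const)
open import Relation.Binary.Definitions using (tri<; tri≈; tri>)
open import Relation.Binary.PropositionalEquality
  using (_≡_; _≢_; refl; sym; trans; cong; cong₂; subst; subst₂; ≢-sym; module ≡-Reasoning)
open import Relation.Nullary using (Dec; yes; no; does; ¬_; contradiction)
open import Relation.Nullary.Decidable using (dec-true; _×-dec_; _→-dec_)
open import Defs

open import Algebra.Properties.AbelianGroup ℤₚ.+-0-abelianGroup using (∙-cancelˡ; ∙-cancelʳ)
open import Algebra.Properties.CommutativeMonoid.Sum *-1-commutativeMonoid using () renaming (sum to ∏; sum-remove to ∏-remove)

-- Finite sums and indicators

-- The sum of f i over i < n.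
∑ : ℕ → (ℕ → ℕ) → ℕ
∑ n f = sum (applyUpTo f n)

-- The indicator of a decided proposition; a sum of indicators counts.
⟦_⟧ : ∀ {p} {P : Set p} → Dec P → ℕ
⟦ P? ⟧ = if does P? then 1 else 0

⟦⟧-yes : ∀ {p} {P : Set p} (P? : Dec P) → P → ⟦ P? ⟧ ≡ 1
⟦⟧-yes P? p rewrite dec-true P? p = refl

⟦⟧-mono : ∀ {p q} {P : Set p} {Q : Set q} (P? : Dec P) (Q? : Dec Q) → (P → Q) → ⟦ P? ⟧ ≤ ⟦ Q? ⟧
⟦⟧-mono (no  _) _       _ = z≤n
⟦⟧-mono (yes p) (yes q) _ = ≤-refl
⟦⟧-mono (yes p) (no ¬q) f = contradiction (f p) ¬q

⟦⟧-∪ : ∀ {p q r} {P : Set p} {Q : Set q} {R : Set r} (P? : Dec P) (Q? : Dec Q) (R? : Dec R) →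
       (P → Q ⊎ R) → ⟦ P? ⟧ ≤ ⟦ Q? ⟧ + ⟦ R? ⟧
⟦⟧-∪ (no  _) _       _       _ = z≤n
⟦⟧-∪ (yes p) (yes q) _       _ = s≤s z≤n
⟦⟧-∪ (yes p) (no ¬q) (yes r) _ = ≤-refl
⟦⟧-∪ (yes p) (no ¬q) (no ¬r) f with f p
... | inj₁ q = contradiction q ¬q
... | inj₂ r = contradiction r ¬r

*-⟦⟧-≤ : ∀ {p} {P : Set p} (P? : Dec P) {c x} → (P → c ≤ x) → c * ⟦ P? ⟧ ≤ x
*-⟦⟧-≤ (no  _) {c} _   = ≤-trans (≤-reflexive (*-zeroʳ c)) z≤n
*-⟦⟧-≤ (yes p) {c} c≤x = ≤-trans (≤-reflexive (*-identityʳ c)) (c≤x p)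

∑-last : ∀ n f → ∑ (suc n) f ≡ ∑ n f + f n
∑-last zero    f = +-comm (f 0) 0
∑-last (suc n) f = trans (cong (λ w → f 0 + w) (∑-last n (f ∘ suc))) (sym (+-assoc (f 0) _ _))

∑-mono : ∀ n {f g} → (∀ {i} → i < n → f i ≤ g i) → ∑ n f ≤ ∑ n g
∑-mono zero    f≤g = z≤n
∑-mono (suc n) f≤g = +-mono-≤ (f≤g z<s) (∑-mono n (f≤g ∘ s<s))

∑-cong : ∀ n {f g} → (∀ {i} → i < n → f i ≡ g i) → ∑ n f ≡ ∑ n g
∑-cong zero    f≡g = refl
∑-cong (suc n) f≡g = cong₂ _+_ (f≡g z<s) (∑-cong n (f≡g ∘ s<s))

∑-const : ∀ n c → ∑ n (λ _ → c) ≡ n * c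
∑-const zero    c = refl
∑-const (suc n) c = cong (λ w → c + w) (∑-const n c)

∑-+ : ∀ n f g → ∑ n (λ i → f i + g i) ≡ ∑ n f + ∑ n g
∑-+ zero    f g = refl
∑-+ (suc n) f g = trans (cong (λ w → (f 0 + g 0) + w) (∑-+ n (f ∘ suc) (g ∘ suc))) (lem (f 0) (g 0) _ _)
  where
  lem : ∀ a b c d → (a + b) + (c + d) ≡ (a + c) + (b + d)
  lem = solve-∀

∑-*ˡ : ∀ n c f → ∑ n (λ i → c * f i) ≡ c * ∑ n f
∑-*ˡ zero    c f = sym (*-zeroʳ c)
∑-*ˡ (suc n) c f = trans (cong (λ w → c * f 0 + w) (∑-*ˡ n c (f ∘ suc))) (sym (*-distribˡ-+ c _ _))

∑-swap : ∀ m n (f : ℕ → ℕ → ℕ) → ∑ m (λ i → ∑ n (f i)) ≡ ∑ n (λ j → ∑ m (λ i → f i j))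
∑-swap zero    n f = sym (trans (∑-const n 0) (*-zeroʳ n))
∑-swap (suc m) n f =
  trans (cong (λ w → ∑ n (f 0) + w) (∑-swap m n (f ∘ suc))) (sym (∑-+ n (f 0) _))

∑-split : ∀ m n f → ∑ (m + n) f ≡ ∑ m f + ∑ n (λ i → f (m + i))
∑-split zero    n f = refl
∑-split (suc m) n f = trans (cong (λ w → f 0 + w) (∑-split m n (f ∘ suc))) (sym (+-assoc (f 0) _ _))

∑-≤ : ∀ n {f c} → (∀ {i} → i < n → f i ≤ c) → ∑ n f ≤ n * c
∑-≤ n {c = c} f≤c = ≤-trans (∑-mono n f≤c) (≤-reflexive (∑-const n c))

∑-monoˡ : ∀ {m n} f → m ≤ n → ∑ m f ≤ ∑ n f
∑-monoˡ {m} f m≤n with k , refl ← m≤n⇒∃[o]m+o≡n m≤n =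
  ≤-trans (m≤m+n _ _) (≤-reflexive (sym (∑-split m k f)))

-- Sums over lists

-- All estimates of σ, from above and from below, rest on this comparison.
sum-⊆ : ∀ {xs ys} → Unique xs → xs ⊆ ys → sum xs ≤ sum ys
sum-⊆ {[]}     _         _     = z≤n
sum-⊆ {x ∷ xs} (x∉ ∷ uq) xs⊆ys with as , bs , refl ← ∈-∃++ (xs⊆ys (here refl)) =
  begin
    x + sum xs              ≤⟨ +-monoʳ-≤ x (sum-⊆ uq sub) ⟩
    x + sum (as ++ bs)      ≡⟨ cong (λ w → x + w) (sum-++ as bs) ⟩
    x + (sum as + sum bs)   ≡⟨ lem x (sum as) (sum bs) ⟩
    sum as + (x + sum bs)   ≡⟨ sum-++ as (x ∷ bs) ⟨
    sum (as ++ x ∷ bs)      ∎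
  where
  open ≤-Reasoning
  lem : ∀ x a b → x + (a + b) ≡ a + (x + b)
  lem = solve-∀
  sub : xs ⊆ as ++ bs
  sub {y} y∈xs with ∈-++⁻ as (xs⊆ys (there y∈xs))
  ... | inj₁ y∈as           = ∈-++⁺ˡ y∈as
  ... | inj₂ (here refl)    = contradiction refl (All.lookup x∉ y∈xs)
  ... | inj₂ (there y∈bs)   = ∈-++⁺ʳ as y∈bs

sum-map-* : ∀ c xs → sum (map (c *_) xs) ≡ c * sum xs
sum-map-* c []       = sym (*-zeroʳ c)
sum-map-* c (x ∷ xs) = trans (cong (λ w → c * x + w) (sum-map-* c xs)) (sym (*-distribˡ-+ c x _))

sum-cartesianProductWith-* : ∀ xs ys → sum (cartesianProductWith _*_ xs ys) ≡ sum xs * sum ys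
sum-cartesianProductWith-* []       ys = refl
sum-cartesianProductWith-* (x ∷ xs) ys = begin
  sum (map (x *_) ys ++ cartesianProductWith _*_ xs ys)      ≡⟨ sum-++ (map (x *_) ys) _ ⟩
  sum (map (x *_) ys) + sum (cartesianProductWith _*_ xs ys) ≡⟨ cong₂ _+_ (sum-map-* x ys) (sum-cartesianProductWith-* xs ys) ⟩
  x * sum ys + sum xs * sum ys                               ≡⟨ *-distribʳ-+ (sum ys) x (sum xs) ⟨
  (x + sum xs) * sum ys                                      ∎
  where open ≡-Reasoning

-- Divisors

∈-divisors⁺ : ∀ {d n} .{{_ : NonZero n}} → d ∣ n → d ∈ divisors n
∈-divisors⁺ {zero}  {suc n} d∣n = contradiction (0∣⇒≡0 d∣n) λ()
∈-divisors⁺ {suc d} {n} d∣n = ∈-filter⁺ (_∣? n) (∈-applyUpTo⁺ suc (∣⇒≤ d∣n)) d∣n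

∈-divisors⁻ : ∀ {d n} → d ∈ divisors n → d ∣ n
∈-divisors⁻ {n = n} d∈ = proj₂ (∈-filter⁻ (_∣? n) {xs = applyUpTo suc n} d∈)

divisors-unique : ∀ n → Unique (divisors n)
divisors-unique n = Unique.filter⁺ (_∣? n) (Unique.applyUpTo⁺₁ suc n λ i<j _ i≡j → <⇒≢ i<j (suc-injective i≡j))

σ-mono-∣ : ∀ {m n} .{{_ : NonZero n}} → m ∣ n → σ m ≤ σ n
σ-mono-∣ {m} m∣n = sum-⊆ (divisors-unique m) λ d∈ → ∈-divisors⁺ (∣-trans (∈-divisors⁻ d∈) m∣n)

n≤σn : ∀ n → n ≤ σ n
n≤σn zero    = z≤n
n≤σn n@(suc _) = ≤-trans (≤-reflexive (sym (+-identityʳ n)))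
  (sum-⊆ {n ∷ []} (All.[] ∷ []) λ { (here refl) → ∈-divisors⁺ ∣-refl })

*-σ≤ : ∀ m n .{{_ : NonZero m}} .{{_ : NonZero n}} → m * σ n ≤ σ (m * n)
*-σ≤ m n = ≤-trans (≤-reflexive (sym (sum-map-* m (divisors n))))
  (sum-⊆ (Unique.map⁺ (*-cancelˡ-≡ _ _ m) (divisors-unique n)) sub)
  where
  sub : map (m *_) (divisors n) ⊆ divisors (m * n)
  sub e∈ with d , d∈ , refl ← ∈-map⁻ (m *_) e∈ =
    ∈-divisors⁺ {{m*n≢0 m n}} (*-monoʳ-∣ m (∈-divisors⁻ d∈))

-- A divisor d of m n is gcd d m times a divisor of n, so it occurs among the
-- products of a divisor of m and a divisor of n.
σ-*-≤ : ∀ m n .{{_ : NonZero m}} .{{_ : NonZero n}} → σ (m * n) ≤ σ m * σ n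
σ-*-≤ m n = ≤-trans (sum-⊆ (divisors-unique (m * n)) sub)
  (≤-reflexive (sum-cartesianProductWith-* (divisors m) (divisors n)))
  where
  sub : divisors (m * n) ⊆ cartesianProductWith _*_ (divisors m) (divisors n)
  sub {d} d∈ = subst (_∈ cartesianProductWith _*_ (divisors m) (divisors n)) (sym d≡)
    (∈-cartesianProductWith⁺ _*_ (∈-divisors⁺ (gcd[m,n]∣n d m)) (∈-divisors⁺ e∣n))
    where
    instance
      m*n≠0 : NonZero (m * n)
      m*n≠0 = m*n≢0 m n
    d∣mn : d ∣ m * n
    d∣mn = ∈-divisors⁻ d∈
    e : ℕ
    e = quotient (gcd[m,n]∣m d m)
    d≡ : d ≡ gcd d m * e
    d≡ = m∣n⇒n≡m*quotient (gcd[m,n]∣m d m)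
    e∣n : e ∣ n
    e∣n = *-cancelˡ-∣ (gcd d m) {{g≠0}} (subst₂ _∣_ d≡ (trans (sym (c*gcd[m,n]≡gcd[cm,cn] n d m)) (*-comm n _))
      (gcd-greatest (n∣m*n n) (subst (d ∣_) (*-comm m n) d∣mn)))
      where
      g≠0 : NonZero (gcd d m)
      g≠0 = ℕ.≢-nonZero (gcd[m,n]≢0 d m (inj₂ (ℕ.≢-nonZero⁻¹ m)))

-- The divisors of m are the numbers m / d for d dividing m, and m / d ≤ X / d.
-- Summing over all d up to one bound X allows averaging over many m ≤ X.
σ-≤-∑ : ∀ {m X} .{{_ : NonZero m}} → m ≤ X → σ m ≤ ∑ X (λ d → ⟦ suc d ∣? m ⟧ * (X / suc d))
σ-≤-∑ {m} {X} m≤X = begin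
  σ m                                         ≤⟨ sum-⊆ (divisors-unique m) sub ⟩
  ∑ m (λ d → ⟦ suc d ∣? m ⟧ * (m / suc d))    ≤⟨ ∑-mono m (λ {d} _ → *-monoʳ-≤ ⟦ suc d ∣? m ⟧ (/-monoˡ-≤ (suc d) m≤X)) ⟩
  ∑ m (λ d → ⟦ suc d ∣? m ⟧ * (X / suc d))    ≤⟨ ∑-monoˡ _ m≤X ⟩
  ∑ X (λ d → ⟦ suc d ∣? m ⟧ * (X / suc d))    ∎
  where
  open ≤-Reasoning
  sub : divisors m ⊆ applyUpTo (λ d → ⟦ suc d ∣? m ⟧ * (m / suc d)) m
  sub {e} e∈ with ∈-divisors⁻ {n = m} e∈
  ... | divides zero    m≡ = contradiction m≡ (ℕ.≢-nonZero⁻¹ m)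
  ... | divides (suc d) m≡ = subst (_∈ applyUpTo f m) fd≡e (∈-applyUpTo⁺ f (∣⇒≤ 1+d∣m))
    where
    f : ℕ → ℕ
    f d = ⟦ suc d ∣? m ⟧ * (m / suc d)
    1+d∣m : suc d ∣ m
    1+d∣m = divides e (trans m≡ (*-comm (suc d) e))
    fd≡e : f d ≡ e
    fd≡e = trans (cong₂ _*_ (⟦⟧-yes (suc d ∣? m) 1+d∣m)
             (trans (cong (_/ suc d) (trans m≡ (*-comm (suc d) e))) (m*n/n≡m e (suc d)))) (*-identityˡ e)

-- Abundant numbers coprime to a given number

Coprime-*ˡ : ∀ {m n o} → Coprime m o → Coprime n o → Coprime (m * n) o
Coprime-*ˡ m⊥o n⊥o {d} (d∣mn , d∣o) = n⊥o (coprime-divisor (λ (x , y) → m⊥o (y , ∣-trans x d∣o)) d∣mn , d∣o)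

Coprime-product : ∀ {xs n} → (∀ {x} → x ∈ xs → Coprime x n) → Coprime (product xs) n
Coprime-product {[]}     _   = Coprime.1-coprimeTo _
Coprime-product {x ∷ xs} cop = Coprime-*ˡ (cop (here refl)) (Coprime-product (cop ∘ there))

module _ (E : ℕ) .{{_ : NonZero E}} where

  -- The series of 1 / (1 + E j) diverges: a block of N terms, N ≤ j < 2 N,
  -- contributes at least 1 / (1 + 2 E). Denominators are cleared by Q.
  harmonic : ∀ n Q (q : ℕ → ℕ) → (∀ {j} → j < 2 ^ n → q j * (1 + E * j) ≡ Q) →
             n * Q ≤ (1 + 2 * E) * ∑ (2 ^ n) q
  harmonic zero    Q q eq = z≤n
  harmonic (suc n) Q q eq = begin
    Q + n * Q                                                     ≤⟨ +-mono-≤ block (harmonic n Q q (λ j< → eq (≤-trans j< (m≤m+n _ _)))) ⟩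
    (1 + 2 * E) * ∑ N (λ i → q (N + i)) + (1 + 2 * E) * ∑ N q     ≡⟨ *-distribˡ-+ (1 + 2 * E) (∑ N (λ i → q (N + i))) (∑ N q) ⟨
    (1 + 2 * E) * (∑ N (λ i → q (N + i)) + ∑ N q)                 ≡⟨ cong ((1 + 2 * E) *_) (+-comm (∑ N (λ i → q (N + i))) (∑ N q)) ⟩
    (1 + 2 * E) * (∑ N q + ∑ N (λ i → q (N + i)))                 ≡⟨ cong ((1 + 2 * E) *_) (trans (sym (∑-split N N q)) (cong (λ k → ∑ k q) (cong (λ w → N + w) (sym (+-identityʳ N))))) ⟩
    (1 + 2 * E) * ∑ (2 ^ suc n) q                                 ∎
    where
    open ≤-Reasoning
    N : ℕ
    N = 2 ^ n
    instance
      N≠0 : NonZero N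
      N≠0 = m^n≢0 2 n
    term : ∀ {i} → i < N → Q ≤ N * ((1 + 2 * E) * q (N + i))
    term {i} i<N = begin
      Q                               ≡⟨ eq (≤-trans (+-monoʳ-< N i<N) (≤-reflexive (cong (λ w → N + w) (sym (+-identityʳ N))))) ⟨
      q (N + i) * (1 + E * (N + i))   ≤⟨ *-monoʳ-≤ (q (N + i)) (+-mono-≤ (ℕ.>-nonZero⁻¹ N) (*-monoʳ-≤ E (+-monoʳ-≤ N (<⇒≤ i<N)))) ⟩
      q (N + i) * (N + E * (N + N))   ≡⟨ lem (q (N + i)) N E ⟩
      N * ((1 + 2 * E) * q (N + i))   ∎
      where
      lem : ∀ q N E → q * (N + E * (N + N)) ≡ N * ((1 + 2 * E) * q)
      lem = solve-∀
    block : Q ≤ (1 + 2 * E) * ∑ N (λ i → q (N + i))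
    block = *-cancelˡ-≤ N (begin
      N * Q                                              ≡⟨ ∑-const N Q ⟨
      ∑ N (λ _ → Q)                                      ≤⟨ ∑-mono N term ⟩
      ∑ N (λ i → N * ((1 + 2 * E) * q (N + i)))          ≡⟨ ∑-*ˡ N N _ ⟩
      N * ∑ N (λ i → (1 + 2 * E) * q (N + i))            ≡⟨ cong (N *_) (∑-*ˡ N (1 + 2 * E) _) ⟩
      N * ((1 + 2 * E) * ∑ N (λ i → q (N + i)))          ∎)

  -- Some Q coprime to E has σ(Q) / Q at least C: the product Q of the numbers
  -- 1 + E j for j < 2 ^ n, which has the distinct divisors Q / (1 + E j).
  abundant : ∀ C → ∃[ Q ] NonZero Q × Coprime Q E × C * Q ≤ σ Q
  abundant C = Q , Q≠0 , Coprime-product cop , *-cancelˡ-≤ (1 + 2 * E) (begin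
    (1 + 2 * E) * (C * Q)            ≡⟨ lem E C Q ⟩
    n * Q                            ≤⟨ harmonic n Q q (λ j< → sym (q-eq j<)) ⟩
    (1 + 2 * E) * ∑ (2 ^ n) q        ≤⟨ *-monoʳ-≤ (1 + 2 * E) (sum-⊆ uniq sub) ⟩
    (1 + 2 * E) * σ Q                ∎)
    where
    open ≤-Reasoning
    lem : ∀ E C Q → (1 + 2 * E) * (C * Q) ≡ C * (1 + 2 * E) * Q
    lem = solve-∀
    n : ℕ
    n = C * (1 + 2 * E)
    fs : List ℕ
    fs = applyUpTo (λ j → 1 + E * j) (2 ^ n)
    Q : ℕ
    Q = product fs
    instance
      Q≠0 : NonZero Q
      Q≠0 = product≢0 (applyUpTo⁺₂ _ (2 ^ n) (λ _ → _))
    cop : ∀ {x} → x ∈ fs → Coprime x E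
    cop x∈ {d} (d∣x , d∣E) with j , _ , refl ← ∈-applyUpTo⁻ (λ j → 1 + E * j) x∈ =
      ∣1⇒≡1 (∣m+n∣m⇒∣n (subst (d ∣_) (+-comm 1 (E * j)) d∣x) (∣m⇒∣m*n j d∣E))
    q : ℕ → ℕ
    q j = Q / (1 + E * j)
    d∣Q : ∀ {j} → j < 2 ^ n → 1 + E * j ∣ Q
    d∣Q j< = ∈⇒∣product (∈-applyUpTo⁺ (λ j → 1 + E * j) j<)
    q-eq : ∀ {j} → j < 2 ^ n → Q ≡ q j * (1 + E * j)
    q-eq j< = sym (m/n*n≡m (d∣Q j<))
    sub : applyUpTo q (2 ^ n) ⊆ divisors Q
    sub x∈ with j , j< , refl ← ∈-applyUpTo⁻ q x∈ = ∈-divisors⁺ (m/n∣m (d∣Q j<))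
    uniq : Unique (applyUpTo q (2 ^ n))
    uniq = Unique.applyUpTo⁺₁ q (2 ^ n) λ {i} {j} i<j j< qi≡qj →
      <⇒≢ i<j (*-cancelˡ-≡ i j E (suc-injective (*-cancelˡ-≡ (1 + E * i) (1 + E * j) (q j)
        {{ℕ.≢-nonZero λ qj≡0 → ℕ.≢-nonZero⁻¹ Q (trans (q-eq j<) (cong (_* (1 + E * j)) qj≡0))}}
        (trans (cong (_* (1 + E * i)) (sym qi≡qj)) (trans (sym (q-eq (<-trans i<j j<))) (q-eq j<))))))

-- The mean value of σ along an arithmetic progression

-- A set of naturals whose distinct elements are at least d / a apart has at
-- most a T / d + 1 elements below T.
module _ {P : ℕ → Set} (P? : ∀ t → Dec (P t)) (a d : ℕ)
         (gap : ∀ {s t} → s < t → P s → P t → a * s + d ≤ a * t) where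

  private
    # : ℕ → ℕ
    # T = ∑ T (λ t → ⟦ P? t ⟧)

  -- If some t ≥ T is itself an element, then each element below T accounts for
  -- the gap up to the next one, and the extra 1 is not needed.
  count-before : ∀ T {t} → T ≤ t → P t → d * # T ≤ a * t
  count-before zero {t} _ _ = ≤-trans (≤-reflexive (*-zeroʳ d)) z≤n
  count-before (suc T) {t} T<t pt rewrite ∑-last T (λ t → ⟦ P? t ⟧) with P? T
  ... | no  _  rewrite +-identityʳ (# T) = count-before T (<⇒≤ T<t) pt
  ... | yes pT = begin
    d * (# T + 1)    ≡⟨ *-distribˡ-+ d (# T) 1 ⟩
    d * # T + d * 1  ≡⟨ cong (λ w → d * # T + w) (*-identityʳ d) ⟩
    d * # T + d      ≤⟨ +-monoˡ-≤ d (count-before T ≤-refl pT) ⟩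
    a * T + d        ≤⟨ gap T<t pT pt ⟩
    a * t            ∎
    where open ≤-Reasoning

  count-gaps : ∀ T → d * # T ≤ a * T + d
  count-gaps zero = ≤-trans (≤-reflexive (*-zeroʳ d)) z≤n
  count-gaps (suc T) rewrite ∑-last T (λ t → ⟦ P? t ⟧) with P? T
  ... | no  _  rewrite +-identityʳ (# T) = ≤-trans (count-gaps T) (+-monoˡ-≤ d (*-monoʳ-≤ a (n≤1+n T)))
  ... | yes pT = begin
    d * (# T + 1)    ≡⟨ *-distribˡ-+ d (# T) 1 ⟩
    d * # T + d * 1  ≡⟨ cong (λ w → d * # T + w) (*-identityʳ d) ⟩
    d * # T + d      ≤⟨ +-monoˡ-≤ d (count-before T ≤-refl pT) ⟩
    a * T + d        ≤⟨ +-monoˡ-≤ d (*-monoʳ-≤ a (n≤1+n T)) ⟩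
    a * suc T + d    ∎
    where open ≤-Reasoning

-- The sum of 1 / d² over 1 ≤ d ≤ n is at most 2, in integers. The induction
-- uses the sharper bound 2 - 1 / n.
∑-floor-squares : ∀ X Y n → ∑ n (λ d → (X / suc d) * (Y / suc d)) ≤ 2 * (X * Y)
∑-floor-squares X Y zero    = z≤n
∑-floor-squares X Y (suc n) = *-cancelˡ-≤ (suc n) (≤-trans (m≤m+n _ Z) (≤-trans (strong n) (≤-reflexive (lem₀ n Z))))
  where
  open ≤-Reasoning
  Z : ℕ
  Z = X * Y
  f : ℕ → ℕ
  f d = (X / suc d) * (Y / suc d)
  lem₀ : ∀ n Z → 2 * suc n * Z ≡ suc n * (2 * Z)
  lem₀ = solve-∀
  f≤ : ∀ d → suc d * suc d * f d ≤ Z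
  f≤ d = begin
    suc d * suc d * f d                       ≡⟨ lem (suc d) (X / suc d) (Y / suc d) ⟩
    (X / suc d * suc d) * (Y / suc d * suc d) ≤⟨ *-mono-≤ (m/n*n≤m X (suc d)) (m/n*n≤m Y (suc d)) ⟩
    X * Y                                     ∎
    where
    lem : ∀ d x y → d * d * (x * y) ≡ (x * d) * (y * d)
    lem = solve-∀
  strong : ∀ n → suc n * ∑ (suc n) f + Z ≤ 2 * suc n * Z
  strong zero    = ≤-trans (+-monoˡ-≤ Z (≤-trans (≤-reflexive (lem (f 0))) (f≤ 0))) (≤-reflexive (lem′ Z))
    where
    lem : ∀ x → 1 * (x + 0) ≡ 1 * x
    lem = solve-∀
    lem′ : ∀ x → x + x ≡ 2 * x
    lem′ = solve-∀
  strong (suc n) = *-cancelˡ-≤ m (begin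
    m * (suc m * ∑ (suc m) f + Z)                  ≡⟨ cong (λ s → m * (suc m * s + Z)) (∑-last m f) ⟩
    m * (suc m * (∑ m f + f m) + Z)                ≡⟨ lem₁ m (∑ m f) (f m) Z ⟩
    suc m * (m * ∑ m f) + (m * suc m * f m + m * Z)  ≤⟨ +-monoʳ-≤ (suc m * (m * ∑ m f)) (+-monoˡ-≤ (m * Z)
                                                        (≤-trans (*-monoˡ-≤ (f m) (*-monoˡ-≤ (suc m) (n≤1+n m))) (f≤ m))) ⟩
    suc m * (m * ∑ m f) + suc m * Z                ≡⟨ *-distribˡ-+ (suc m) (m * ∑ m f) Z ⟨
    suc m * (m * ∑ m f + Z)                        ≤⟨ *-monoʳ-≤ (suc m) (strong n) ⟩
    suc m * (2 * m * Z)                            ≡⟨ lem₂ m Z ⟩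
    m * (2 * suc m * Z)                            ∎)
    where
    m : ℕ
    m = suc n
    lem₁ : ∀ m s f Z → m * (suc m * (s + f) + Z) ≡ suc m * (m * s) + (m * suc m * f + m * Z)
    lem₁ = solve-∀
    lem₂ : ∀ m Z → suc m * (2 * m * Z) ≡ m * (2 * suc m * Z)
    lem₂ = solve-∀

-- The hypothesis is that every d divides A t + B only for t spaced at least
-- d / a apart. Then the mean of σ(A t + B) over t < T is at most 2 a + 2 times
-- the bound A T + B for the arguments; this constant does not involve A or B.
module _ (a A B : ℕ) .{{_ : NonZero A}} .{{_ : NonZero B}}
         (gap : ∀ {d s t} → s < t → d ∣ A * s + B → d ∣ A * t + B → a * s + d ≤ a * t) where

  mean-σ : ∀ T → A + B ≤ T → ∑ T (λ t → σ (A * t + B)) ≤ (2 * a + 2) * ((A * T + B) * T)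
  mean-σ T A+B≤T = begin
    ∑ T (λ t → σ (A * t + B))
      ≤⟨ ∑-mono T (λ {t} t<T → σ-≤-∑ {{m+n≢0 t}} (+-monoˡ-≤ B (*-monoʳ-≤ A (<⇒≤ t<T)))) ⟩
    ∑ T (λ t → ∑ X (λ d → ⟦ suc d ∣? A * t + B ⟧ * (X / suc d)))
      ≡⟨ ∑-swap T X _ ⟩
    ∑ X (λ d → ∑ T (λ t → ⟦ suc d ∣? A * t + B ⟧ * (X / suc d)))
      ≤⟨ ∑-mono X (λ {d} _ → column d) ⟩
    ∑ X (λ d → (X / suc d) * (a * T / suc d) + X / suc d)
      ≡⟨ ∑-+ X _ _ ⟩
    ∑ X (λ d → (X / suc d) * (a * T / suc d)) + ∑ X (λ d → X / suc d)
      ≤⟨ +-mono-≤ (∑-floor-squares X (a * T) X) tail ⟩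
    2 * (X * (a * T)) + 2 * (X * T)
      ≡⟨ lem a X T ⟩
    (2 * a + 2) * (X * T) ∎
    where
    open ≤-Reasoning
    X : ℕ
    X = A * T + B
    m+n≢0 : ∀ t → NonZero (A * t + B)
    m+n≢0 t = ℕ.>-nonZero (≤-trans (ℕ.>-nonZero⁻¹ B) (m≤n+m B (A * t)))
    lem : ∀ a X T → 2 * (X * (a * T)) + 2 * (X * T) ≡ (2 * a + 2) * (X * T)
    lem = solve-∀
    count≤ : ∀ d → ∑ T (λ t → ⟦ suc d ∣? A * t + B ⟧) ≤ a * T / suc d + 1
    count≤ d = begin
      N                        ≡⟨ m*n/n≡m N (suc d) ⟨
      N * suc d / suc d        ≤⟨ /-monoˡ-≤ (suc d) (≤-trans (≤-reflexive (*-comm N (suc d)))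
                                    (count-gaps (λ t → suc d ∣? A * t + B) a (suc d) gap T)) ⟩
      (a * T + suc d) / suc d  ≡⟨ +-distrib-/-∣ʳ (a * T) ∣-refl ⟩
      a * T / suc d + suc d / suc d  ≡⟨ cong (λ w → a * T / suc d + w) (n/n≡1 (suc d)) ⟩
      a * T / suc d + 1        ∎
      where
      N : ℕ
      N = ∑ T (λ t → ⟦ suc d ∣? A * t + B ⟧)
    column : ∀ d → ∑ T (λ t → ⟦ suc d ∣? A * t + B ⟧ * (X / suc d)) ≤ (X / suc d) * (a * T / suc d) + X / suc d
    column d = begin
      ∑ T (λ t → ⟦ suc d ∣? A * t + B ⟧ * (X / suc d))  ≡⟨ ∑-cong T (λ {t} _ → *-comm ⟦ suc d ∣? A * t + B ⟧ (X / suc d)) ⟩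
      ∑ T (λ t → (X / suc d) * ⟦ suc d ∣? A * t + B ⟧)  ≡⟨ ∑-*ˡ T (X / suc d) _ ⟩
      (X / suc d) * ∑ T (λ t → ⟦ suc d ∣? A * t + B ⟧)  ≤⟨ *-monoʳ-≤ (X / suc d) (count≤ d) ⟩
      (X / suc d) * (a * T / suc d + 1)                 ≡⟨ *-distribˡ-+ (X / suc d) (a * T / suc d) 1 ⟩
      (X / suc d) * (a * T / suc d) + (X / suc d) * 1   ≡⟨ cong (λ w → (X / suc d) * (a * T / suc d) + w) (*-identityʳ (X / suc d)) ⟩
      (X / suc d) * (a * T / suc d) + X / suc d         ∎
    T≠0 : NonZero T
    T≠0 = ℕ.>-nonZero (≤-trans (ℕ.>-nonZero⁻¹ A) (≤-trans (m≤m+n A B) A+B≤T))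
    T≤X : T ≤ X
    T≤X = ≤-trans (m≤n*m T A) (m≤m+n (A * T) B)
    X≤ : X ≤ (A + B) * T
    X≤ = ≤-trans (+-monoʳ-≤ (A * T) (m≤m*n B T {{T≠0}})) (≤-reflexive (sym (*-distribʳ-+ T A B)))
    X/[1+d]≤T : ∀ d → X / suc (T + d) ≤ T
    X/[1+d]≤T d = begin
      X / suc (T + d)      ≤⟨ /-mono-≤ {{_}} {{T≠0}} X≤ (≤-trans (m≤m+n T d) (n≤1+n _)) ⟩
      _/_ ((A + B) * T) T {{T≠0}} ≡⟨ m*n/n≡m (A + B) T {{T≠0}} ⟩
      A + B                ≤⟨ A+B≤T ⟩
      T                    ∎
    -- The contribution of the 1 in the count a T / d + 1. It is small since the
    -- terms with d > T are at most A + B, which is at most T.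
    tail : ∑ X (λ d → X / suc d) ≤ 2 * (X * T)
    tail = begin
      ∑ X (λ d → X / suc d)                                  ≡⟨ cong (λ k → ∑ k (λ d → X / suc d)) (m+[n∸m]≡n T≤X) ⟨
      ∑ (T + (X ∸ T)) (λ d → X / suc d)                      ≡⟨ ∑-split T (X ∸ T) (λ d → X / suc d) ⟩
      ∑ T (λ d → X / suc d) + ∑ (X ∸ T) (λ d → X / suc (T + d)) ≤⟨ +-mono-≤ (∑-≤ T (λ {d} _ → m/n≤m X (suc d))) (∑-≤ (X ∸ T) (λ {d} _ → X/[1+d]≤T d)) ⟩
      T * X + (X ∸ T) * T                                    ≤⟨ +-monoʳ-≤ (T * X) (*-monoˡ-≤ T (m∸n≤m X T)) ⟩
      T * X + X * T                                          ≡⟨ lem′ T X ⟩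
      2 * (X * T)                                            ∎
      where
      lem′ : ∀ T X → T * X + X * T ≡ 2 * (X * T)
      lem′ = solve-∀

-- Products and congruences

∣∏ : ∀ {n} (q : Fin n → ℕ) i → q i ∣ ∏ q
∣∏ q zero    = m∣m*n _
∣∏ q (suc i) = ∣n⇒∣m*n (q zero) (∣∏ (q ∘ suc) i)

∏≢0 : ∀ {n} (q : Fin n → ℕ) → (∀ i → NonZero (q i)) → NonZero (∏ q)
∏≢0 {zero}  q q≢0 = _
∏≢0 {suc n} q q≢0 = m*n≢0 _ _ {{q≢0 zero}} {{∏≢0 (q ∘ suc) (q≢0 ∘ suc)}}

Coprime-∏ : ∀ {n} (q : Fin n → ℕ) {m} → (∀ i → Coprime (q i) m) → Coprime (∏ q) m
Coprime-∏ {zero}  q q⊥m = Coprime.1-coprimeTo _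
Coprime-∏ {suc n} q q⊥m = Coprime-*ˡ (q⊥m zero) (Coprime-∏ (q ∘ suc) (q⊥m ∘ suc))

-- The product c of the q j with j ≠ i.
cofactor : ∀ {n} (q : Fin n → ℕ) i → ∃[ c ] ∏ q ≡ q i * c × (∀ {m} → (∀ j → j ≢ i → Coprime (q j) m) → Coprime c m)
cofactor {suc n} q i = ∏ (q ∘ punchIn i) , ∏-remove {i = i} q ,
  λ q⊥m → Coprime-∏ (q ∘ punchIn i) (λ j → q⊥m (punchIn i j) (punchInᵢ≢i i j))

≤⇒∣! : ∀ {m n} .{{_ : NonZero m}} → m ≤ n → m ∣ n !
≤⇒∣! {suc m} m≤n = ∣-trans (m∣m*n (m !)) (m≤n⇒m!∣n! m≤n)

-- If d divides two numbers whose difference is nonzero and at most W, then d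
-- divides W !.
∣-difference-< : ∀ {d x y W} z → x < y → y ≤ W → d ∣ z + x → d ∣ z + y → d ∣ W !
∣-difference-< {d} {x} z x<y y≤W d∣x d∣y with o , refl ← m≤n⇒∃[o]m+o≡n x<y =
  ∣-trans (∣m+n∣m⇒∣n (subst (d ∣_) (trans (cong (λ w → z + w) (sym (+-suc x o))) (sym (+-assoc z x (suc o)))) d∣y) d∣x)
          (≤⇒∣! {suc o} (≤-trans (s≤s (m≤n+m o x)) y≤W))

∣-difference : ∀ {d x y W} z → x ≢ y → x ≤ W → y ≤ W → d ∣ z + x → d ∣ z + y → d ∣ W !
∣-difference {x = x} {y} z x≢y x≤W y≤W d∣x d∣y with <-cmp x y
... | tri< x<y _ _ = ∣-difference-< z x<y y≤W d∣x d∣y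
... | tri≈ _ x≡y _ = contradiction x≡y x≢y
... | tri> _ _ y<x = ∣-difference-< z y<x x≤W d∣y d∣x

solve-mod : ∀ {q e} .{{_ : NonZero q}} → Coprime q e → ∀ b → ∃[ s ] q ∣ e * s + b
solve-mod {suc q} {e} q⊥e b with coprime-Bézout q⊥e
... | Bézout.+- x y eq = y * b , divides (x * b) (begin
  e * (y * b) + b        ≡⟨ lem e y b ⟩
  (1 + y * e) * b        ≡⟨ cong (_* b) eq ⟩
  x * suc q * b          ≡⟨ lem′ x (suc q) b ⟩
  x * b * suc q          ∎)
  where
  open ≡-Reasoning
  lem : ∀ e y b → e * (y * b) + b ≡ (1 + y * e) * b
  lem = solve-∀
  lem′ : ∀ x q b → x * q * b ≡ x * b * q
  lem′ = solve-∀
... | Bézout.-+ x y eq = y * q * b , divides (x * q * b + b) (begin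
  e * (y * q * b) + b             ≡⟨ lem e y q b ⟩
  y * e * (q * b) + b             ≡⟨ cong (λ z → z * (q * b) + b) eq ⟨
  (1 + x * suc q) * (q * b) + b   ≡⟨ lem′ x q b ⟩
  (x * q * b + b) * suc q         ∎)
  where
  open ≡-Reasoning
  lem : ∀ e y q b → e * (y * q * b) + b ≡ y * e * (q * b) + b
  lem = solve-∀
  lem′ : ∀ x q b → (1 + x * suc q) * (q * b) + b ≡ (x * q * b + b) * suc q
  lem′ = solve-∀

-- The Chinese remainder theorem, for simultaneous linear congruences.
crt : ∀ {k} (q a B : Fin k → ℕ) → (∀ i → NonZero (q i)) →
      (∀ i j → i ≢ j → Coprime (q i) (q j)) → (∀ i → Coprime (q i) (a i)) →
      ∃[ s ] (∀ i → q i ∣ a i * s + B i)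
crt {zero}  q a B _   _      _   = 0 , λ ()
crt {suc k} q a B q≢0 q⊥q q⊥a
  with s , q∣s ← crt (q ∘ suc) (a ∘ suc) (B ∘ suc) (q≢0 ∘ suc) (λ i j i≢j → q⊥q (suc i) (suc j) λ { refl → i≢j refl }) (q⊥a ∘ suc)
  with u , q∣u ← solve-mod {{q≢0 zero}} (Coprime.sym (Coprime-*ˡ (Coprime.sym (q⊥a zero)) (Coprime-∏ (q ∘ suc) (λ i → q⊥q (suc i) zero λ ())))) (a zero * s + B zero)
  = s + P * u , λ
    { zero    → subst (q zero ∣_) (lem (a zero) P s u (B zero)) q∣u
    ; (suc i) → subst (q (suc i) ∣_) (lem′ (a (suc i)) P s u (B (suc i)))
                  (∣m∣n⇒∣m+n (∣n⇒∣m*n (a (suc i)) (∣m⇒∣m*n u (∣∏ (q ∘ suc) i))) (q∣s i)) }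
  where
  P : ℕ
  P = ∏ (q ∘ suc)
  lem : ∀ a P s u b → a * P * u + (a * s + b) ≡ a * (s + P * u) + b
  lem = solve-∀
  lem′ : ∀ a P s u b → a * (P * u) + (a * s + b) ≡ a * (s + P * u) + b
  lem′ = solve-∀

-- Pairwise coprime abundant numbers

-- Pairwise coprime numbers, coprime to D, each of which is more abundant than
-- the preceding ones by a factor of at least H: since Q i ≥ 1, the growth
-- condition implies σ(Q j) / Q j ≥ H σ(Q i) / Q i.
record AbundantSequence (D H : ℕ) : Set where
  field
    Q        : ℕ → ℕ
    Q≢0      : ∀ m → NonZero (Q m)
    coprime  : ∀ m → Coprime (Q m) D
    coprimes : ∀ {i j} → i < j → Coprime (Q j) (Q i)
    growth   : ∀ {i j} → i < j → H * σ (Q i) * Q j ≤ σ (Q j)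

abundantSequence : ∀ D H .{{_ : NonZero D}} → AbundantSequence D H
abundantSequence D H {{D≢0}} = record
  { Q        = Q
  ; Q≢0      = λ m → proj₁ (Q-spec m)
  ; coprime  = λ m (d∣Q , d∣D) → proj₁ (proj₂ (Q-spec m)) (d∣Q , ∣-trans d∣D (D∣P m))
  ; coprimes = λ {_} {j} i<j (d∣Qj , d∣Qi) → proj₁ (proj₂ (Q-spec j)) (d∣Qj , ∣-trans d∣Qi (Q∣P i<j))
  ; growth   = λ {i} {j} i<j → ≤-trans (*-monoˡ-≤ (Q j) (*-monoʳ-≤ H (σ-mono-∣ {{P≢0 j}} (Q∣P i<j)))) (proj₂ (proj₂ (Q-spec j)))
  }
  where
  step : ((P , _) : Σ[ P ∈ ℕ ] NonZero P) → ∃[ Q ] NonZero Q × Coprime Q P × H * σ P * Q ≤ σ Q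
  step (P , P≢0) = abundant P {{P≢0}} (H * σ P)
  -- The product of D and the first m members of the sequence.
  chain : ℕ → Σ[ P ∈ ℕ ] NonZero P
  chain zero    = D , ℕ.≢-nonZero (ℕ.≢-nonZero⁻¹ D)
  chain (suc m) = proj₁ (chain m) * proj₁ (step (chain m)) , m*n≢0 _ _ {{proj₂ (chain m)}} {{proj₁ (proj₂ (step (chain m)))}}
  P : ℕ → ℕ
  P m = proj₁ (chain m)
  P≢0 : ∀ m → NonZero (P m)
  P≢0 m = proj₂ (chain m)
  Q : ℕ → ℕ
  Q m = proj₁ (step (chain m))
  Q-spec : ∀ m → NonZero (Q m) × Coprime (Q m) (P m) × H * σ (P m) * Q m ≤ σ (Q m)
  Q-spec m = proj₂ (step (chain m))
  D∣P : ∀ m → D ∣ P m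
  D∣P zero    = ∣-refl
  D∣P (suc m) = ∣m⇒∣m*n (Q m) (D∣P m)
  Q∣P : ∀ {i j} → i < j → Q i ∣ P j
  Q∣P {i} {suc j} i<1+j with m<1+n⇒m<n∨m≡n i<1+j
  ... | inj₁ i<j  = ∣m⇒∣m*n (Q j) (Q∣P i<j)
  ... | inj₂ refl = n∣m*n (P i)

-- Positive lower density

/-mono : ∀ m n p q .{{_ : NonZero n}} .{{_ : NonZero q}} → m * q ≤ p * n → + m ℚ./ n ℚ.≤ + p ℚ./ q
/-mono m (suc n) p (suc q) mq≤pn = ℚₚ.toℚᵘ-cancel-≤
  (ℚᵘₚ.≤-respʳ-≃ (ℚᵘₚ.≃-sym (ℚₚ.toℚᵘ-fromℚᵘ (ℚᵘ.mkℚᵘ (+ p) q))) (ℚᵘₚ.≤-respˡ-≃ (ℚᵘₚ.≃-sym (ℚₚ.toℚᵘ-fromℚᵘ (ℚᵘ.mkℚᵘ (+ m) n)))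
    (ℚᵘ.*≤* (subst₂ ℤ._≤_ (ℤₚ.pos-* m (suc q)) (ℤₚ.pos-* p (suc n)) (+≤+ mq≤pn)))))

/-mono-< : ∀ m n p q .{{_ : NonZero n}} .{{_ : NonZero q}} → m * q < p * n → + m ℚ./ n ℚ.< + p ℚ./ q
/-mono-< m (suc n) p (suc q) mq≤pn = ℚₚ.toℚᵘ-cancel-<
  (ℚᵘₚ.<-respʳ-≃ (ℚᵘₚ.≃-sym (ℚₚ.toℚᵘ-fromℚᵘ (ℚᵘ.mkℚᵘ (+ p) q))) (ℚᵘₚ.<-respˡ-≃ (ℚᵘₚ.≃-sym (ℚₚ.toℚᵘ-fromℚᵘ (ℚᵘ.mkℚᵘ (+ m) n)))
    (ℚᵘ.*<* (subst₂ ℤ._<_ (ℤₚ.pos-* m (suc q)) (ℤₚ.pos-* p (suc n)) (+<+ mq≤pn)))))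

≤-numerator : ∀ q → q ℚ.≤ + ℤ.∣ ℚ.↥ q ∣ ℚ./ 1
≤-numerator q@record{} = ℚₚ.toℚᵘ-cancel-≤ (ℚᵘₚ.≤-respʳ-≃ (ℚᵘₚ.≃-sym (ℚₚ.toℚᵘ-fromℚᵘ (ℚᵘ.mkℚᵘ (+ ℤ.∣ ℚ.↥ q ∣) 0)))
  (ℚᵘ.*≤* (lem (ℚ.↥ q) (ℚ.denominator-1 q))))
  where
  lem : ∀ i n → i ℤ.* + 1 ℤ.≤ + ℤ.∣ i ∣ ℤ.* + suc n
  lem i n = ℤₚ.≤-trans (ℤₚ.≤-reflexive (ℤₚ.*-identityʳ i)) (ℤₚ.≤-trans (i≤∣i∣ i)
    (subst (+ ℤ.∣ i ∣ ℤ.≤_) (ℤₚ.pos-* ℤ.∣ i ∣ (suc n)) (+≤+ (m≤m*n ℤ.∣ i ∣ (suc n)))))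
    where
    i≤∣i∣ : ∀ i → i ℤ.≤ + ℤ.∣ i ∣
    i≤∣i∣ (+ n)        = ℤₚ.≤-refl
    i≤∣i∣ (ℤ.-[1+ n ]) = ℤ.-≤+

∣tabulate∣ : ∀ n (f : ℕ → Bool) → ∣ tabulate {n = n} (f ∘ toℕ) ∣ ≡ ∑ n (λ i → if f i then 1 else 0)
∣tabulate∣ zero    f = refl
∣tabulate∣ (suc n) f with f 0
... | true  = cong suc (∣tabulate∣ n (f ∘ suc))
... | false = ∣tabulate∣ n (f ∘ suc)

∑-progression : ∀ (f : ℕ → ℕ) s M .{{_ : NonZero M}} T → ∑ T (λ t → f (s + M * t)) ≤ ∑ (s + M * T) f
∑-progression f s M zero = z≤n
∑-progression f s M (suc T) = begin
  ∑ (suc T) (λ t → f (s + M * t))              ≡⟨ ∑-last T _ ⟩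
  ∑ T (λ t → f (s + M * t)) + f (s + M * T)    ≤⟨ +-monoˡ-≤ (f (s + M * T)) (∑-progression f s M T) ⟩
  ∑ (s + M * T) f + f (s + M * T)              ≡⟨ ∑-last (s + M * T) f ⟨
  ∑ (suc (s + M * T)) f                        ≤⟨ ∑-monoˡ f (≤-trans (≤-reflexive (sym (+-suc s (M * T)))) (+-monoʳ-≤ s 1+MT≤)) ⟩
  ∑ (s + M * suc T) f                          ∎
  where
  open ≤-Reasoning
  1+MT≤ : suc (M * T) ≤ M * suc T
  1+MT≤ = ≤-trans (+-monoˡ-≤ (M * T) (ℕ.>-nonZero⁻¹ M)) (≤-reflexive (sym (*-suc M T)))

PositiveLowerDensity-mono : ∀ {ℓ ℓ′} (S : ℕ → Set ℓ) (S′ : ℕ → Set ℓ′) → (∀ {n} → S n → S′ n) →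
                            PositiveLowerDensity S → PositiveLowerDensity S′
PositiveLowerDensity-mono S S′ S⊆S′ (r , 0<r , N , large) =
  r , 0<r , N , λ x N≤x → let (p , p⊆S , r≤) = large x N≤x in p , (λ i∈p → S⊆S′ (p⊆S i∈p)) , r≤

-- A set has positive lower density if, for all large T, it contains at least
-- T / 2 of the terms s + 1 + M t with t < 2 T. The 1 comes from positivity:
-- the index i in the definition of density stands for i + 1.
module _ {ℓ} {S : ℕ → Set ℓ} (S? : ∀ n → Dec (S n)) (s M T₀ : ℕ) .{{_ : NonZero M}} where

  positiveLowerDensity : (∀ T → T₀ ≤ T → T ≤ 2 * ∑ (2 * T) (λ t → ⟦ S? (suc (s + M * t)) ⟧)) →
                         PositiveLowerDensity S
  positiveLowerDensity many = (+ 1 ℚ./ R) , ℚₚ.positive⁻¹ (+ 1 ℚ./ R) {{ℚₚ.normalize-pos 1 R}} , N , large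
    where
    open ≤-Reasoning
    R N : ℕ
    R = 10 * M
    N = s + (1 + s + T₀) * (2 * M)
    instance
      2M≢0 : NonZero (2 * M)
      2M≢0 = m*n≢0 2 M
      R≢0 : NonZero R
      R≢0 = m*n≢0 10 M
    -- T is chosen with 2 M T ≤ x - s < 2 M (T + 1), whence x ≤ 5 M T.
    large : ∀ x → .{{_ : NonZero x}} → N ≤ x → AtLeast (+ 1 ℚ./ R) S x
    large x N≤x = p , p⊆S , /-mono 1 R ∣ p ∣ x (begin
      1 * x                    ≡⟨ *-identityˡ x ⟩
      x                        ≡⟨ m+[n∸m]≡n s≤x ⟨
      s + y                    ≡⟨ cong (λ z → s + z) (m≡m%n+[m/n]*n y (2 * M)) ⟩
      s + (y % (2 * M) + T * (2 * M)) ≤⟨ +-mono-≤ s≤MT (+-monoˡ-≤ (T * (2 * M)) (≤-trans (<⇒≤ (m%n<n y (2 * M))) (m≤n*m (2 * M) T {{ℕ.>-nonZero 1≤T}}))) ⟩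
      M * T + (T * (2 * M) + T * (2 * M)) ≡⟨ lem M T ⟩
      5 * M * T                ≤⟨ *-monoʳ-≤ (5 * M) (many T T₀≤T) ⟩
      5 * M * (2 * ∑ (2 * T) (λ t → g (s + M * t))) ≤⟨ *-monoʳ-≤ (5 * M) (*-monoʳ-≤ 2 (∑-progression g s M (2 * T))) ⟩
      5 * M * (2 * ∑ (s + M * (2 * T)) g)           ≤⟨ *-monoʳ-≤ (5 * M) (*-monoʳ-≤ 2 (∑-monoˡ g inRange)) ⟩
      5 * M * (2 * ∑ x g)      ≡⟨ lem′ M (∑ x g) ⟩
      ∑ x g * R                ≡⟨ cong (_* R) (∣tabulate∣ x (λ i → does (S? (suc i)))) ⟨
      ∣ p ∣ * R                ∎)
      where
      g : ℕ → ℕ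
      g i = ⟦ S? (suc i) ⟧
      p : Subset x
      p = tabulate (λ i → does (S? (suc (toℕ i))))
      p⊆S : ∀ {i : Fin x} → i ∈ₛ p → S (suc (toℕ i))
      p⊆S {i} i∈p with S? (suc (toℕ i)) | trans (sym (lookup∘tabulate (λ i → does (S? (suc (toℕ i)))) i)) ([]=⇒lookup i∈p)
      ... | yes sᵢ | _ = sᵢ
      y T : ℕ
      y = x ∸ s
      T = y / (2 * M)
      s≤x : s ≤ x
      s≤x = ≤-trans (m≤m+n s _) N≤x
      T≥ : 1 + s + T₀ ≤ T
      T≥ = ≤-trans (≤-reflexive (sym (m*n/n≡m (1 + s + T₀) (2 * M)))) (/-monoˡ-≤ (2 * M) (m+n≤o⇒m≤o∸n _ (≤-trans (≤-reflexive (+-comm _ s)) N≤x)))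
      1≤T : 1 ≤ T
      1≤T = ≤-trans (s≤s z≤n) T≥
      T₀≤T : T₀ ≤ T
      T₀≤T = ≤-trans (m≤n+m T₀ (1 + s)) T≥
      s≤MT : s ≤ M * T
      s≤MT = ≤-trans (≤-trans (≤-trans (n≤1+n s) (m≤m+n (1 + s) T₀)) T≥) (m≤n*m T M)
      inRange : s + M * (2 * T) ≤ x
      inRange = ≤-trans (+-monoʳ-≤ s (≤-trans (≤-reflexive (lem″ M T)) (m/n*n≤m y (2 * M)))) (≤-reflexive (m+[n∸m]≡n s≤x))
        where
        lem″ : ∀ M T → M * (2 * T) ≡ T * (2 * M)
        lem″ = solve-∀
      lem : ∀ M T → M * T + (T * (2 * M) + T * (2 * M)) ≡ 5 * M * T
      lem = solve-∀
      lem′ : ∀ M g → 5 * M * (2 * g) ≡ g * (10 * M)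
      lem′ = solve-∀

-- Exceptional sets

markov : ∀ c f n → c * ∑ n (λ t → ⟦ c <? f t ⟧) ≤ ∑ n f
markov c f n = ≤-trans (≤-reflexive (sym (∑-*ˡ n c _))) (∑-mono n (λ {t} _ → *-⟦⟧-≤ (c <? f t) <⇒≤))

union-bound : ∀ {k} {P : Fin k → ℕ → Set} (P? : ∀ i t → Dec (P i t)) {m c n} →
              (∀ i → m * ∑ n (λ t → ⟦ P? i t ⟧) ≤ c) →
              m * ∑ n (λ t → ⟦ any? (λ i → P? i t) ⟧) ≤ k * c
union-bound {zero}  P? {m} {c} {n} each = ≤-reflexive (trans (cong (m *_) (trans (∑-const n 0) (*-zeroʳ n))) (*-zeroʳ m))
union-bound {suc k} P? {m} {c} {n} each = begin
  m * ∑ n (λ t → ⟦ any? (λ i → P? i t) ⟧)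
    ≤⟨ *-monoʳ-≤ m (∑-mono n (λ {t} _ → ⟦⟧-∪ (any? (λ i → P? i t)) (P? zero t) (any? (λ i → P? (suc i) t))
         λ { (zero , p) → inj₁ p ; (suc i , p) → inj₂ (i , p) })) ⟩
  m * ∑ n (λ t → ⟦ P? zero t ⟧ + ⟦ any? (λ i → P? (suc i) t) ⟧)
    ≡⟨ cong (m *_) (∑-+ n _ _) ⟩
  m * (∑ n (λ t → ⟦ P? zero t ⟧) + ∑ n (λ t → ⟦ any? (λ i → P? (suc i) t) ⟧))
    ≡⟨ *-distribˡ-+ m (∑ n (λ t → ⟦ P? zero t ⟧)) _ ⟩
  m * ∑ n (λ t → ⟦ P? zero t ⟧) + m * ∑ n (λ t → ⟦ any? (λ i → P? (suc i) t) ⟧)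
    ≤⟨ +-mono-≤ (each zero) (union-bound (P? ∘ suc) {m} {c} {n} (each ∘ suc)) ⟩
  c + k * c ∎
  where open ≤-Reasoning

-- Linear forms with natural coefficients

-- The forms a i n + B i, pairwise non-proportional, with distinct ranks.
module NaturalForms {k} (a B rank : Fin k → ℕ) (a≢0 : ∀ i → NonZero (a i)) (B≢0 : ∀ i → NonZero (B i))
            (rank-distinct : ∀ i j → i ≢ j → rank i ≢ rank j)
            (independent : ∀ i j → i ≢ j → a i * B j ≢ a j * B i) (K : ℕ) where

  L : Fin k → ℕ → ℕ
  L i n = a i * n + B i

  -- The values of the forms at n are ordered as the ranks, by factors above K.
  Good : ℕ → Set
  Good n = ∀ i j → rank j < rank i → K * σ (L j n) < σ (L i n)

  good? : ∀ n → Dec (Good n)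
  good? n = all? λ i → all? λ j → (rank j <? rank i) →-dec (K * σ (L j n) <? σ (L i n))

  private
    -- β bounds all coefficients and W also all determinants, so that each of these
    -- divides D. Λ is large enough that at most T / 2 of the t < 2 T are
    -- discarded. At the others, σ of a cofactor m is at most 2 Λ m, and H
    -- outweighs K, this factor 2 Λ, and the factor β between any two forms.
    β W D Λ H : ℕ
    β = ∏ a * ∏ B
    W = β + β * β
    D = W !
    Λ = 8 * (suc k * (β + 1))
    H = 1 + K * (2 * Λ * β)

    instance
      β≢0 : NonZero β
      β≢0 = m*n≢0 _ _ {{∏≢0 a a≢0}} {{∏≢0 B B≢0}}

    a≤β : ∀ i → a i ≤ β
    a≤β i = ∣⇒≤ (∣m⇒∣m*n (∏ B) (∣∏ a i))

    B≤β : ∀ i → B i ≤ β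
    B≤β i = ∣⇒≤ (∣n⇒∣m*n (∏ a) (∣∏ B i))

    L≢0 : ∀ i n → NonZero (L i n)
    L≢0 i n = ℕ.>-nonZero (≤-trans (ℕ.>-nonZero⁻¹ (B i) {{B≢0 i}}) (m≤n+m (B i) (a i * n)))

    L-comparable : ∀ i j n → L j n ≤ β * L i n
    L-comparable i j n = begin
      a j * n + B j                ≤⟨ +-mono-≤ (*-monoˡ-≤ n (a≤β j)) (B≤β j) ⟩
      β * n + β                    ≡⟨ cong (λ w → β * n + w) (*-identityʳ β) ⟨
      β * n + β * 1                ≡⟨ *-distribˡ-+ β n 1 ⟨
      β * (n + 1)                  ≤⟨ *-monoʳ-≤ β (+-mono-≤ (m≤n*m n (a i) {{a≢0 i}}) (ℕ.>-nonZero⁻¹ (B i) {{B≢0 i}})) ⟩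
      β * (a i * n + B i)          ∎
      where open ≤-Reasoning

    -- A common divisor of two values divides the determinant of the two forms,
    -- and hence D.
    common-divisor : ∀ {d i j n} → i ≢ j → d ∣ L i n → d ∣ L j n → d ∣ D
    common-divisor {d} {i} {j} {n} i≢j d∣Li d∣Lj =
      ∣-difference (a i * a j * n) (independent i j i≢j)
        (≤-trans (*-mono-≤ (a≤β i) (B≤β j)) (m≤n+m (β * β) β))
        (≤-trans (*-mono-≤ (a≤β j) (B≤β i)) (m≤n+m (β * β) β))
        (subst (d ∣_) (lem (a i) (a j) n (B j)) (∣n⇒∣m*n (a i) d∣Lj))
        (subst (d ∣_) (lem′ (a i) (a j) n (B i)) (∣n⇒∣m*n (a j) d∣Li))
      where
      lem : ∀ a a′ n b → a * (a′ * n + b) ≡ a * a′ * n + a * b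
      lem = solve-∀
      lem′ : ∀ a a′ n b → a′ * (a * n + b) ≡ a * a′ * n + a′ * b
      lem′ = solve-∀

    open AbundantSequence (abundantSequence D H {{W !≢0}})

    q : Fin k → ℕ
    q i = Q (rank i)

    q≢0 : ∀ i → NonZero (q i)
    q≢0 i = Q≢0 (rank i)

    q⊥q : ∀ i j → i ≢ j → Coprime (q i) (q j)
    q⊥q i j i≢j with <-cmp (rank i) (rank j)
    ... | tri< i<j _ _ = Coprime.sym (coprimes i<j)
    ... | tri≈ _ i≡j _ = contradiction i≡j (rank-distinct i j i≢j)
    ... | tri> _ _ j<i = coprimes j<i

    q⊥a : ∀ i → Coprime (q i) (a i)
    q⊥a i (d∣q , d∣a) = coprime (rank i) (d∣q , ∣-trans d∣a (≤⇒∣! {{a≢0 i}} (≤-trans (a≤β i) (m≤m+n β (β * β)))))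

  -- On the class of s modulo M, each form is divisible by its own q.
  residue : ∃[ s ] (∀ i → q i ∣ a i * s + B i)
  residue = crt q a B q≢0 q⊥q q⊥a

  s M : ℕ
  s = proj₁ residue
  M = ∏ q

  instance
    M≢0 : NonZero M
    M≢0 = ∏≢0 q q≢0

  private
    -- On that class, at s + M t, the form L i is q i times m i t = A i t + e i.
    c e A : Fin k → ℕ
    c i = proj₁ (cofactor q i)
    e i = quotient (proj₂ residue i)
    A i = a i * c i

    M≡ : ∀ i → M ≡ q i * c i
    M≡ i = proj₁ (proj₂ (cofactor q i))

    A≢0 : ∀ i → NonZero (A i)
    A≢0 i = m*n≢0 (a i) (c i) {{a≢0 i}} {{m*n≢0⇒n≢0 (q i) {{subst NonZero (M≡ i) M≢0}}}}

    e≢0 : ∀ i → NonZero (e i)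
    e≢0 i = m*n≢0⇒m≢0 (e i) {q i} {{subst NonZero (m∣n⇒n≡quotient*m (proj₂ residue i)) (L≢0 i s)}}

    m : Fin k → ℕ → ℕ
    m i t = A i * t + e i

    L≡ : ∀ i t → L i (s + M * t) ≡ q i * m i t
    L≡ i t = begin
      a i * (s + M * t) + B i               ≡⟨ cong (λ M → a i * (s + M * t) + B i) (M≡ i) ⟩
      a i * (s + q i * c i * t) + B i       ≡⟨ lem (a i) s (q i) (c i) t (B i) ⟩
      a i * s + B i + q i * (a i * c i * t) ≡⟨ cong (_+ q i * (a i * c i * t)) (m∣n⇒n≡m*quotient (proj₂ residue i)) ⟩
      q i * e i + q i * (a i * c i * t)     ≡⟨ lem′ (q i) (e i) _ ⟩
      q i * (a i * c i * t + e i)           ∎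
      where
      open ≡-Reasoning
      lem : ∀ a s q c t B → a * (s + q * c * t) + B ≡ a * s + B + q * (a * c * t)
      lem = solve-∀
      lem′ : ∀ q e x → q * e + q * x ≡ q * (x + e)
      lem′ = solve-∀

    q∣L : ∀ i t → q i ∣ L i (s + M * t)
    q∣L i t = subst (q i ∣_) (sym (L≡ i t)) (m∣m*n (m i t))

    -- The other q j are coprime to m i t, since a common divisor would divide D.
    -- So their product c i is coprime to each divisor of m i t.
    m⊥c : ∀ i t {d} → d ∣ m i t → Coprime (c i) d
    m⊥c i t {d} d∣m = proj₂ (proj₂ (cofactor q i)) λ j j≢i {g} (g∣q , g∣d) →
      coprime (rank j) (g∣q , common-divisor j≢i (∣-trans g∣q (q∣L j t))
        (subst (g ∣_) (sym (L≡ i t)) (∣n⇒∣m*n (q i) (∣-trans g∣d d∣m))))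

    -- Thus a common divisor d of m i t and m i u divides a i (u - t), whatever
    -- M is: this frees the mean value of σ(m i t) from the choice of the q j.
    gap : ∀ i {d t u} → t < u → d ∣ m i t → d ∣ m i u → a i * t + d ≤ a i * u
    gap i {d} {t} {u} t<u d∣t d∣u = begin
      a i * t + d           ≤⟨ +-monoʳ-≤ (a i * t) (∣⇒≤ {{m*n≢0 (a i) (u ∸ t) {{a≢0 i}} {{ℕ.>-nonZero (m<n⇒0<n∸m t<u)}}}} d∣) ⟩
      a i * t + a i * (u ∸ t) ≡⟨ *-distribˡ-+ (a i) t (u ∸ t) ⟨
      a i * (t + (u ∸ t))     ≡⟨ cong (a i *_) t+[u∸t]≡u ⟩
      a i * u                 ∎
      where
      open ≤-Reasoning
      t+[u∸t]≡u : t + (u ∸ t) ≡ u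
      t+[u∸t]≡u = m+[n∸m]≡n (<⇒≤ t<u)
      lem : ∀ a c t o e → a * c * (t + o) + e ≡ (a * c * t + e) + c * (a * o)
      lem = solve-∀
      d∣ : d ∣ a i * (u ∸ t)
      d∣ = coprime-divisor (Coprime.sym (m⊥c i t d∣t)) (∣m+n∣m⇒∣n
             (subst (d ∣_) (trans (cong (m i) (sym t+[u∸t]≡u)) (lem (a i) (c i) t (u ∸ t) (e i))) d∣u) d∣t)

    -- A bound for m i t if t < 2 T, and at most 2 (m i t) if T ≤ t.
    X : ℕ → Fin k → ℕ
    X T i = m i (2 * T)

    -- The t to be discarded on account of the form L i.
    bad? : ∀ T i t → Dec (Λ * X T i < σ (m i t))
    bad? T i t = Λ * X T i <? σ (m i t)

    few-bad : ∀ i T → A i + e i ≤ T → 2 * suc k * ∑ (2 * T) (λ t → ⟦ bad? T i t ⟧) ≤ T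
    few-bad i T large = *-cancelˡ-≤ Y {{Y≢0}} (begin
      Y * (2 * suc k * N)              ≡⟨ lem (β + 1) (X T i) (suc k) N ⟩
      Λ * X T i * N                    ≤⟨ markov (Λ * X T i) (σ ∘ m i) (2 * T) ⟩
      ∑ (2 * T) (σ ∘ m i)              ≤⟨ mean-σ (a i) (A i) (e i) {{A≢0 i}} {{e≢0 i}} (gap i) (2 * T) (≤-trans large (m≤n*m T 2)) ⟩
      (2 * a i + 2) * (X T i * (2 * T)) ≤⟨ *-monoˡ-≤ (X T i * (2 * T)) (+-monoˡ-≤ 2 (*-monoʳ-≤ 2 (a≤β i))) ⟩
      (2 * β + 2) * (X T i * (2 * T))  ≡⟨ lem′ β (X T i) T ⟩
      Y * T                            ∎)
      where
      open ≤-Reasoning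
      Y N : ℕ
      Y = 4 * ((β + 1) * X T i)
      N = ∑ (2 * T) (λ t → ⟦ bad? T i t ⟧)
      Y≢0 : NonZero Y
      Y≢0 = m*n≢0 4 ((β + 1) * X T i) {{_}} {{m*n≢0 (β + 1) (X T i) {{ℕ.>-nonZero (m≤n+m 1 β)}} {{ℕ.>-nonZero (≤-trans (ℕ.>-nonZero⁻¹ (e i) {{e≢0 i}}) (m≤n+m (e i) _))}}}}
      lem : ∀ b x k n → 4 * (b * x) * (2 * k * n) ≡ 8 * (k * b) * x * n
      lem = solve-∀
      lem′ : ∀ b x T → (2 * b + 2) * (x * (2 * T)) ≡ 4 * ((b + 1) * x) * T
      lem′ = solve-∀

    good : ∀ T {t} → T ≤ t → (∀ i → ¬ (Λ * X T i < σ (m i t))) → Good (s + M * t)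
    good T {t} T≤t not-bad i j j<i = begin-strict
      K * σ (L j n)                          ≤⟨ *-monoʳ-≤ K upper ⟩
      K * (σ (q j) * (2 * Λ * (β * L i n)))  ≡⟨ lem K (σ (q j)) (2 * Λ) β (L i n) ⟩
      K * (2 * Λ * β) * (σ (q j) * L i n)    <⟨ m<n+m _ (ℕ.>-nonZero⁻¹ _ {{m*n≢0 _ _ {{ℕ.>-nonZero (≤-trans (ℕ.>-nonZero⁻¹ _ {{q≢0 j}}) (n≤σn (q j)))}} {{L≢0 i n}}}}) ⟩
      H * (σ (q j) * L i n)                  ≤⟨ lower ⟩
      σ (L i n)                              ∎
      where
      open ≤-Reasoning
      n : ℕ
      n = s + M * t
      lem : ∀ K x y b l → K * (x * (y * (b * l))) ≡ K * (y * b) * (x * l)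
      lem = solve-∀
      m≢0 : ∀ i → NonZero (m i t)
      m≢0 i = ℕ.>-nonZero (≤-trans (ℕ.>-nonZero⁻¹ (e i) {{e≢0 i}}) (m≤n+m (e i) _))
      X≤ : X T j ≤ 2 * m j t
      X≤ = begin
        A j * (2 * T) + e j     ≤⟨ +-mono-≤ (*-monoʳ-≤ (A j) (*-monoʳ-≤ 2 T≤t)) (m≤n*m (e j) 2) ⟩
        A j * (2 * t) + 2 * e j ≡⟨ lem₁ (A j) t (e j) ⟩
        2 * (A j * t + e j)     ∎
        where
        lem₁ : ∀ A t e → A * (2 * t) + 2 * e ≡ 2 * (A * t + e)
        lem₁ = solve-∀
      upper : σ (L j n) ≤ σ (q j) * (2 * Λ * (β * L i n))
      upper = begin
        σ (L j n)                          ≡⟨ cong σ (L≡ j t) ⟩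
        σ (q j * m j t)                    ≤⟨ σ-*-≤ (q j) (m j t) {{q≢0 j}} {{m≢0 j}} ⟩
        σ (q j) * σ (m j t)                ≤⟨ *-monoʳ-≤ (σ (q j)) (≮⇒≥ (not-bad j)) ⟩
        σ (q j) * (Λ * X T j)              ≤⟨ *-monoʳ-≤ (σ (q j)) (*-monoʳ-≤ Λ X≤) ⟩
        σ (q j) * (Λ * (2 * m j t))        ≡⟨ lem₁ (σ (q j)) Λ (m j t) ⟩
        σ (q j) * (2 * Λ * m j t)          ≤⟨ *-monoʳ-≤ (σ (q j)) (*-monoʳ-≤ (2 * Λ) (m≤n*m (m j t) (q j) {{q≢0 j}})) ⟩
        σ (q j) * (2 * Λ * (q j * m j t))  ≡⟨ cong (λ l → σ (q j) * (2 * Λ * l)) (L≡ j t) ⟨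
        σ (q j) * (2 * Λ * L j n)          ≤⟨ *-monoʳ-≤ (σ (q j)) (*-monoʳ-≤ (2 * Λ) (L-comparable i j n)) ⟩
        σ (q j) * (2 * Λ * (β * L i n))    ∎
        where
        lem₁ : ∀ s l m → s * (l * (2 * m)) ≡ s * (2 * l * m)
        lem₁ = solve-∀
      lower : H * (σ (q j) * L i n) ≤ σ (L i n)
      lower = begin
        H * (σ (q j) * L i n)              ≡⟨ cong (λ l → H * (σ (q j) * l)) (L≡ i t) ⟩
        H * (σ (q j) * (q i * m i t))      ≡⟨ lem₁ H (σ (q j)) (q i) (m i t) ⟩
        m i t * (H * σ (q j) * q i)        ≤⟨ *-monoʳ-≤ (m i t) (growth j<i) ⟩
        m i t * σ (q i)                    ≤⟨ *-σ≤ (m i t) (q i) {{m≢0 i}} {{q≢0 i}} ⟩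
        σ (m i t * q i)                    ≡⟨ cong σ (trans (*-comm (m i t) (q i)) (sym (L≡ i t))) ⟩
        σ (L i n)                          ∎
        where
        lem₁ : ∀ h s q m → h * (s * (q * m)) ≡ m * (h * s * q)
        lem₁ = solve-∀

  -- A product serves as a bound for its positive factors.
  T₀ : ℕ
  T₀ = ∏ (λ i → A i + e i)

  many-good : ∀ T → T₀ ≤ T → T ≤ 2 * ∑ (2 * T) (λ t → ⟦ good? (s + M * t) ⟧)
  many-good T T₀≤T = +-cancelʳ-≤ T T (2 * G) (begin
    T + T                     ≤⟨ +-mono-≤ T≤ T≤ ⟩
    (G + N) + (G + N)         ≡⟨ lem G N ⟩
    2 * G + 2 * N             ≤⟨ +-monoʳ-≤ (2 * G) 2N≤T ⟩
    2 * G + T                 ∎)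
    where
    open ≤-Reasoning
    g b : ℕ → ℕ
    g t = ⟦ good? (s + M * t) ⟧
    b t = ⟦ any? (λ i → bad? T i t) ⟧
    G N : ℕ
    G = ∑ (2 * T) g
    N = ∑ (2 * T) b
    lem : ∀ g n → (g + n) + (g + n) ≡ 2 * g + 2 * n
    lem = solve-∀
    2N≤T : 2 * N ≤ T
    2N≤T = *-cancelˡ-≤ (suc k) (begin
      suc k * (2 * N)         ≡⟨ lem₁ (suc k) N ⟩
      2 * suc k * N           ≤⟨ union-bound (bad? T) {2 * suc k} {T} {2 * T} (λ i → few-bad i T (≤-trans (A+e≤T₀ i) T₀≤T)) ⟩
      k * T                   ≤⟨ *-monoˡ-≤ T (n≤1+n k) ⟩
      suc k * T               ∎)
      where
      lem₁ : ∀ k n → k * (2 * n) ≡ 2 * k * n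
      lem₁ = solve-∀
      A+e≢0 : ∀ i → NonZero (A i + e i)
      A+e≢0 i = ℕ.>-nonZero (≤-trans (ℕ.>-nonZero⁻¹ (e i) {{e≢0 i}}) (m≤n+m (e i) (A i)))
      A+e≤T₀ : ∀ i → A i + e i ≤ T₀
      A+e≤T₀ i = ∣⇒≤ {{∏≢0 _ A+e≢0}} (∣∏ (λ i → A i + e i) i)
    T≤ : T ≤ G + N
    T≤ = begin
      T                                       ≡⟨ *-identityʳ T ⟨
      T * 1                                   ≡⟨ ∑-const T 1 ⟨
      ∑ T (λ _ → 1)                           ≤⟨ ∑-mono T (λ {u} _ → ⟦⟧-∪ (yes tt) (good? _) (any? (λ i → bad? T i (T + u))) λ _ → dichotomy u) ⟩
      ∑ T (λ u → g (T + u) + b (T + u))       ≡⟨ ∑-+ T _ _ ⟩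
      ∑ T (λ u → g (T + u)) + ∑ T (λ u → b (T + u)) ≤⟨ +-mono-≤ (half g) (half b) ⟩
      G + N                                   ∎
      where
      half : ∀ f → ∑ T (λ u → f (T + u)) ≤ ∑ (2 * T) f
      half f = ≤-trans (m≤n+m _ (∑ T f)) (≤-reflexive (trans (sym (∑-split T T f)) (cong (λ n → ∑ n f) (cong (λ w → T + w) (sym (+-identityʳ T))))))
      dichotomy : ∀ u → Good (s + M * (T + u)) ⊎ (∃[ i ] Λ * X T i < σ (m i (T + u)))
      dichotomy u = either (any? (λ i → bad? T i (T + u)))
        where
        either : Dec (∃[ i ] Λ * X T i < σ (m i (T + u))) → Good (s + M * (T + u)) ⊎ (∃[ i ] Λ * X T i < σ (m i (T + u)))
        either (yes bad) = inj₂ bad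
        either (no ¬bad) = inj₁ (good T (m≤m+n T u) (λ i bad → ¬bad (i , bad)))

-- Linear forms with integer coefficients

affine-positive : ∀ {a} b {n} → 0 < a → ℤ.∣ b ∣ < n → ∃[ B ] NonZero B × affine a b n ≡ + B
affine-positive {a@(suc _)} (+ b) {n@(suc _)} _ b<n = a * n + b , _ , cong (λ z → z ℤ.+ + b) (sym (ℤₚ.pos-* a n))
affine-positive {a@(suc _)} -[1+ b ] {n} _ b<n =
  a * n ∸ suc b , ℕ.>-nonZero (m<n⇒0<n∸m b<an) ,
  trans (cong (ℤ._+ -[1+ b ]) (sym (ℤₚ.pos-* a n))) (ℤₚ.⊖-≥ (<⇒≤ b<an))
  where
  b<an : suc b < a * n
  b<an = ≤-trans b<n (m≤n*m n a)

affine-+ : ∀ a b m n {B} → affine a b m ≡ + B → affine a b (m + n) ≡ + (a * n + B)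
affine-+ a b m n {B} eq = begin
  + a ℤ.* + (m + n) ℤ.+ b                ≡⟨ cong (λ z → + a ℤ.* z ℤ.+ b) (ℤₚ.pos-+ m n) ⟩
  + a ℤ.* (+ m ℤ.+ + n) ℤ.+ b            ≡⟨ lem (+ a) (+ m) (+ n) b ⟩
  + a ℤ.* + n ℤ.+ (+ a ℤ.* + m ℤ.+ b)    ≡⟨ cong₂ ℤ._+_ (sym (ℤₚ.pos-* a n)) eq ⟩
  + (a * n) ℤ.+ + B                      ≡⟨ ℤₚ.pos-+ (a * n) B ⟨
  + (a * n + B)                          ∎
  where
  open ≡-Reasoning
  lem : ∀ a m n b → a ℤ.* (m ℤ.+ n) ℤ.+ b ≡ a ℤ.* n ℤ.+ (a ℤ.* m ℤ.+ b)
  lem = ℤ-Solver.solve-∀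

-- At n, the forms are positive, and a form of higher rank has a value of σ more
-- than K times that of a form of lower rank.
Ranked : ∀ {k} → (Fin k → ℕ) → (Fin k → ℤ) → (Fin k → ℕ) → ℕ → ℕ → Set
Ranked a b rank K n =
  (∀ i → 0ℤ ℤ.< affine (a i) (b i) n) ×
  (∀ i j → rank j < rank i → K * σ ℤ.∣ affine (a j) (b j) n ∣ < σ ℤ.∣ affine (a i) (b i) n ∣)

module _ {k} (a : Fin k → ℕ) (b : Fin k → ℤ) (rank : Fin k → ℕ) (a>0 : ∀ i → 0 < a i)
         (rank-distinct : ∀ i j → i ≢ j → rank i ≢ rank j)
         (independent : ∀ i j → i ≢ j → + a i ℤ.* b j ≢ + a j ℤ.* b i) (K : ℕ) where

  ranked-σ : PositiveLowerDensity (Ranked a b rank K)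
  ranked-σ = PositiveLowerDensity-mono S (Ranked a b rank K) meaning (positiveLowerDensity S? (N + s) M T₀ many)
    where
    -- From N₀ on, all forms are positive, so the forms in n - N₀ have natural
    -- coefficients.
    N N₀ : ℕ
    N  = ∏ (λ i → suc ℤ.∣ b i ∣)
    N₀ = suc N
    value : ∀ i → ∃[ B ] NonZero B × affine (a i) (b i) N₀ ≡ + B
    value i = affine-positive (b i) (a>0 i) (s≤s (≤-trans (n≤1+n _) (∣⇒≤ {{∏≢0 (λ i → suc ℤ.∣ b i ∣) (λ _ → _)}} (∣∏ (λ i → suc ℤ.∣ b i ∣) i))))
    B : Fin k → ℕ
    B i = proj₁ (value i)
    B≡ : ∀ i → affine (a i) (b i) N₀ ≡ + B i
    B≡ i = proj₂ (proj₂ (value i))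
    independent′ : ∀ i j → i ≢ j → a i * B j ≢ a j * B i
    independent′ i j i≢j eq = independent i j i≢j
      (∙-cancelˡ (+ a i ℤ.* (+ a j ℤ.* + N₀)) _ _ (begin
        + a i ℤ.* (+ a j ℤ.* + N₀) ℤ.+ + a i ℤ.* b j  ≡⟨ ℤₚ.*-distribˡ-+ (+ a i) _ (b j) ⟨
        + a i ℤ.* affine (a j) (b j) N₀               ≡⟨ cong (+ a i ℤ.*_) (B≡ j) ⟩
        + a i ℤ.* + B j                               ≡⟨ ℤₚ.pos-* (a i) (B j) ⟨
        + (a i * B j)                                 ≡⟨ cong +_ eq ⟩
        + (a j * B i)                                 ≡⟨ ℤₚ.pos-* (a j) (B i) ⟩
        + a j ℤ.* + B i                               ≡⟨ cong (+ a j ℤ.*_) (B≡ i) ⟨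
        + a j ℤ.* affine (a i) (b i) N₀               ≡⟨ lem (+ a i) (+ a j) (+ N₀) (b i) ⟩
        + a i ℤ.* (+ a j ℤ.* + N₀) ℤ.+ + a j ℤ.* b i  ∎))
      where
      open ≡-Reasoning
      lem : ∀ a a′ n b → a′ ℤ.* (a ℤ.* n ℤ.+ b) ≡ a ℤ.* (a′ ℤ.* n) ℤ.+ a′ ℤ.* b
      lem = ℤ-Solver.solve-∀
    open NaturalForms a B rank (λ i → ℕ.>-nonZero (a>0 i)) (λ i → proj₁ (proj₂ (value i))) rank-distinct independent′ K
    S : ℕ → Set
    S n = N₀ ≤ n × Good (n ∸ N₀)
    S? : ∀ n → Dec (S n)
    S? n = (N₀ ≤? n) ×-dec good? (n ∸ N₀)
    shifted : ∀ {m} → Good m → S (suc (N + m))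
    shifted {m} g = m≤m+n N₀ m , subst Good (sym (m+n∸m≡n N₀ m)) g
    many : ∀ T → T₀ ≤ T → T ≤ 2 * ∑ (2 * T) (λ t → ⟦ S? (suc (N + s + M * t)) ⟧)
    many T T₀≤T = ≤-trans (many-good T T₀≤T) (*-monoʳ-≤ 2 (∑-mono (2 * T) (λ {t} _ →
      ⟦⟧-mono (good? (s + M * t)) (S? _) (subst (S ∘ suc) (sym (+-assoc N s (M * t))) ∘ shifted))))
    meaning : ∀ {n} → S n → Ranked a b rank K n
    meaning {n} (N₀≤n , g) =
      (λ i → subst (0ℤ ℤ.<_) (sym (affine≡ i)) (+<+ (≤-trans (ℕ.>-nonZero⁻¹ (B i) {{proj₁ (proj₂ (value i))}}) (m≤n+m (B i) _)))) ,
      λ i j j<i → subst₂ (λ x y → K * σ ℤ.∣ x ∣ < σ ℤ.∣ y ∣) (sym (affine≡ j)) (sym (affine≡ i)) (g i j j<i)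
      where
      affine≡ : ∀ i → affine (a i) (b i) n ≡ + L i (n ∸ N₀)
      affine≡ i = trans (cong (affine (a i) (b i)) (sym (m+[n∸m]≡n N₀≤n))) (affine-+ (a i) (b i) N₀ (n ∸ N₀) (B≡ i))

-- Descending chains

module _ {k} (a : Fin k → ℕ) (a>0 : ∀ i → 0 < a i) (b : Fin k → ℤ)
         (independent : ∀ i j → i <ᶠ j → + a i ℤ.* b j ≢ + a j ℤ.* b i) where

  -- At n, the forms are positive, and each has a value of σ more than K times that
  -- of the next one.
  Descending : ℕ → ℕ → Set
  Descending K n = (∀ i → 0ℤ ℤ.< affine (a i) (b i) n) ×
    (∀ i j → toℕ j ≡ suc (toℕ i) → K * σ ℤ.∣ affine (a j) (b j) n ∣ < σ ℤ.∣ affine (a i) (b i) n ∣)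

  -- The same with a real factor, in terms of the ratios of consecutive values.
  DescendingRatio : ℝ → ℕ → Set
  DescendingRatio C n = Σ[ pos ∈ (∀ i → 0ℤ ℤ.< affine (a i) (b i) n) ]
    (∀ i j → toℕ j ≡ suc (toℕ i) → C <ℝℚ σ-ratio (pos i) (pos j))

  descending-σ : ∀ K → PositiveLowerDensity (Descending K)
  descending-σ K = PositiveLowerDensity-mono (Ranked a b (λ i → k ∸ toℕ i) K) (Descending K)
    (λ (pos , chain) → pos , λ i j j≡1+i →
      chain i j (∸-monoʳ-< (≤-reflexive (sym j≡1+i)) (<⇒≤ (toℕ<n j))))
    (ranked-σ a b (λ i → k ∸ toℕ i) a>0
      (λ i j i≢j eq → i≢j (toℕ-injective (∸-cancelˡ-≡ (<⇒≤ (toℕ<n i)) (<⇒≤ (toℕ<n j)) eq)))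
      independent′ K)
    where
    independent′ : ∀ i j → i ≢ j → + a i ℤ.* b j ≢ + a j ℤ.* b i
    independent′ i j i≢j with <ᶠ-cmp i j
    ... | tri< i<j _ _ = independent i j i<j
    ... | tri≈ _ i≡j _ = contradiction i≡j i≢j
    ... | tri> _ _ j<i = ≢-sym (independent j i j<i)

  -- The case K = 1, without the factor.
  DescendingStrictly : ℕ → Set
  DescendingStrictly n = (∀ i → 0ℤ ℤ.< affine (a i) (b i) n) ×
    (∀ i j → toℕ j ≡ suc (toℕ i) → σ ℤ.∣ affine (a i) (b i) n ∣ > σ ℤ.∣ affine (a j) (b j) n ∣)

  descending-σ-strictly : PositiveLowerDensity DescendingStrictly
  descending-σ-strictly = PositiveLowerDensity-mono (Descending 1) DescendingStrictly
    (λ {n} (pos , chain) → pos , λ i j j≡1+i →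
      subst (_< σ ℤ.∣ affine (a i) (b i) n ∣) (*-identityˡ (σ ℤ.∣ affine (a j) (b j) n ∣)) (chain i j j≡1+i))
    (descending-σ 1)

  -- The inequality C < σ-ratio is witnessed by the term of index 0 of C, which
  -- is within 1 of C.
  descending-σ-ratio : ∀ C → PositiveLowerDensity (DescendingRatio C)
  descending-σ-ratio C = PositiveLowerDensity-mono (Descending K) (DescendingRatio C)
    (λ {n} (pos , chain) → pos , λ i j j≡1+i → 0 , ℚₚ.≤-<-trans (≤-numerator c₀)
      (/-mono-< K 1 (σ ℤ.∣ affine (a i) (b i) n ∣) (σ ℤ.∣ affine (a j) (b j) n ∣) {{_}} {{σ-nonZero (pos j)}}
        (≤-trans (chain i j j≡1+i) (≤-reflexive (sym (*-identityʳ (σ ℤ.∣ affine (a i) (b i) n ∣)))))))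
    (descending-σ K)
    where
    c₀ : ℚ
    c₀ = seq C 0 ℚ.+ + 1 ℚ./ 1
    K : ℕ
    K = ℤ.∣ ℚ.↥ c₀ ∣

-- Prescribed signs

0<-difference : ∀ {m n} → m < n → 0ℤ ℤ.< + n ℤ.- + m
0<-difference {m} {n} m<n = subst (0ℤ ℤ.<_) (sym (trans (ℤₚ.m-n≡m⊖n n m) (ℤₚ.⊖-≥ (<⇒≤ m<n)))) (+<+ (m<n⇒0<n∸m m<n))

module _ {k} (ε : Fin k → ℤ) (ε=±1 : ∀ i → ε i ≡ -1ℤ ⊎ ε i ≡ 1ℤ) where

  private
    -- The rank of n + 1 is in the middle, and each later n + i + 1 is placed above
    -- or below all previous ones, as the sign demands.
    rank : Fin (suc k) → ℕ
    rank zero    = suc k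
    rank (suc i) = [ const (suc k + toℕ (suc i)) , const (suc k ∸ toℕ (suc i)) ]′ (ε=±1 i)

    -- In particular the ranks are distinct.
    rank-distance : ∀ i → ℕ.∣ suc k - rank i ∣ ≡ toℕ i
    rank-distance zero = ∣n-n∣≡0 (suc k)
    rank-distance (suc i) with ε=±1 i
    ... | inj₁ _ = ∣m-m+n∣≡n (suc k) (toℕ (suc i))
    ... | inj₂ _ = trans (m≤n⇒∣n-m∣≡n∸m (m∸n≤m (suc k) (toℕ (suc i)))) (m∸[m∸n]≡n (<⇒≤ (toℕ<n (suc i))))

    rank-≤ : ∀ i → rank i ≤ suc k + toℕ i
    rank-≤ zero = m≤m+n (suc k) 0
    rank-≤ (suc i) with ε=±1 i
    ... | inj₁ _ = ≤-refl
    ... | inj₂ _ = ≤-trans (m∸n≤m (suc k) (toℕ (suc i))) (m≤m+n (suc k) _)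

    rank-≥ : ∀ i → suc k ∸ toℕ i ≤ rank i
    rank-≥ zero = ≤-refl
    rank-≥ (suc i) with ε=±1 i
    ... | inj₁ _ = ≤-trans (m∸n≤m (suc k) (toℕ (suc i))) (m≤m+n (suc k) _)
    ... | inj₂ _ = ≤-refl

  -- The differences σ(n + i + 1) - σ(n + i + 2), for i < k, have the signs ε.
  PrescribedSigns : ℕ → Set
  PrescribedSigns n = ∀ i → ε i ℤ.* (+ σ (n + (toℕ i + 1)) ℤ.- + σ (n + (toℕ i + 2))) ℤ.> 0ℤ

  prescribed-signs : PositiveLowerDensity PrescribedSigns
  prescribed-signs = PositiveLowerDensity-mono (Ranked (λ _ → 1) b rank 1) PrescribedSigns
    (λ {n} (_ , compare) i → signs n i (λ x y y<x → subst₂ _<_ (trans (+-identityʳ _) (value y n)) (value x n) (compare x y y<x)))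
    (ranked-σ (λ _ → 1) b rank (λ _ → z<s)
      (λ i j i≢j eq → i≢j (toℕ-injective (trans (sym (rank-distance i)) (trans (cong (λ r → ℕ.∣ suc k - r ∣) eq) (rank-distance j)))))
      (λ i j i≢j eq → i≢j (sym (toℕ-injective (+-cancelʳ-≡ 1 (toℕ j) (toℕ i) (ℤₚ.+-injective
        (trans (sym (ℤₚ.*-identityˡ (b j))) (trans eq (ℤₚ.*-identityˡ (b i)))))))))
      1)
    where
    b : Fin (suc k) → ℤ
    b i = + (toℕ i + 1)
    value : ∀ i n → σ ℤ.∣ affine 1 (+ (toℕ i + 1)) n ∣ ≡ σ (n + (toℕ i + 1))
    value i n = cong (λ z → σ ℤ.∣ z ℤ.+ + (toℕ i + 1) ∣) (ℤₚ.*-identityˡ (+ n))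
    here≡ : ∀ (i : Fin k) → toℕ (inject₁ i) + 1 ≡ toℕ i + 1
    here≡ i = cong (_+ 1) (toℕ-inject₁ i)
    next≡ : ∀ (i : Fin k) → suc (toℕ i) + 1 ≡ toℕ i + 2
    next≡ i = sym (+-suc (toℕ i) 1)
    signs : ∀ n i → (∀ (x y : Fin (suc k)) → rank y < rank x → σ (n + (toℕ y + 1)) < σ (n + (toℕ x + 1))) →
            ε i ℤ.* (+ σ (n + (toℕ i + 1)) ℤ.- + σ (n + (toℕ i + 2))) ℤ.> 0ℤ
    signs n i compare with ε=±1 i | compare (suc i) (inject₁ i) | compare (inject₁ i) (suc i)
    ... | inj₁ ε≡-1 | up | _ rewrite ε≡-1 =
      subst (0ℤ ℤ.<_) (lem (+ σ (n + (toℕ i + 1))) (+ σ (n + (toℕ i + 2)))) (0<-difference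
        (subst₂ (λ x y → σ (n + x) < σ (n + y)) (here≡ i) (next≡ i)
          (up (≤-<-trans (rank-≤ (inject₁ i)) (+-monoʳ-< (suc k) (s≤s (≤-reflexive (toℕ-inject₁ i))))))))
      where
      lem : ∀ x y → y ℤ.- x ≡ -1ℤ ℤ.* (x ℤ.- y)
      lem = ℤ-Solver.solve-∀
    ... | inj₂ ε≡1 | _ | down rewrite ε≡1 =
      subst (0ℤ ℤ.<_) (sym (ℤₚ.*-identityˡ _)) (0<-difference
        (subst₂ (λ x y → σ (n + x) < σ (n + y)) (next≡ i) (here≡ i)
          (down (<-≤-trans (∸-monoʳ-< (s≤s (≤-reflexive (toℕ-inject₁ i))) (<⇒≤ (toℕ<n (suc i)))) (rank-≥ (inject₁ i))))))

-- Comparison of two linear forms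

affine-shift : ∀ a b i n → affine a (+ a ℤ.* i ℤ.+ b) n ≡ + a ℤ.* (+ n ℤ.+ i) ℤ.+ b
affine-shift a b i n = lem (+ a) b i (+ n)
  where
  lem : ∀ a b i n → a ℤ.* n ℤ.+ (a ℤ.* i ℤ.+ b) ≡ a ℤ.* (n ℤ.+ i) ℤ.+ b
  lem = ℤ-Solver.solve-∀

-- As Ranked, for the values of one form at the N integers from n on.
RankedTranslates : ∀ (a : ℕ) (b : ℤ) {N} → (Fin N → ℕ) → ℕ → ℕ → Set
RankedTranslates a b {N} rank K n =
  (∀ (i : Fin N) → 0ℤ ℤ.< affine a b (n + toℕ i)) ×
  (∀ i j → rank j < rank i → K * σ ℤ.∣ affine a b (n + toℕ j) ∣ < σ ℤ.∣ affine a b (n + toℕ i) ∣)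

module _ (a : ℕ) (a>0 : 0 < a) (b : ℤ) {N} (rank : Fin N → ℕ)
         (rank-distinct : ∀ i j → i ≢ j → rank i ≢ rank j) (K : ℕ) where

  ranked-translates : PositiveLowerDensity (RankedTranslates a b rank K)
  ranked-translates = PositiveLowerDensity-mono (Ranked (λ _ → a) (λ i → + a ℤ.* + toℕ i ℤ.+ b) rank K) (RankedTranslates a b rank K)
    (λ {n} (pos , compare) → (λ i → subst (0ℤ ℤ.<_) (form n i) (pos i)) ,
      λ i j j<i → subst₂ (λ x y → K * σ ℤ.∣ x ∣ < σ ℤ.∣ y ∣) (form n j) (form n i) (compare i j j<i))
    (ranked-σ (λ _ → a) (λ i → + a ℤ.* + toℕ i ℤ.+ b) rank (λ _ → a>0) rank-distinct independent K)
    where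
    instance
      a≢0 : NonZero a
      a≢0 = ℕ.>-nonZero a>0
    form : ∀ n (i : Fin N) → affine a (+ a ℤ.* + toℕ i ℤ.+ b) n ≡ affine a b (n + toℕ i)
    form n i = trans (affine-shift a b (+ toℕ i) n) (cong (λ z → + a ℤ.* z ℤ.+ b) (sym (ℤₚ.pos-+ n (toℕ i))))
    independent : ∀ i j → i ≢ j → + a ℤ.* (+ a ℤ.* + toℕ j ℤ.+ b) ≢ + a ℤ.* (+ a ℤ.* + toℕ i ℤ.+ b)
    independent i j i≢j eq = i≢j (sym (toℕ-injective (ℤₚ.+-injective
      (ℤₚ.*-cancelˡ-≡ (+ a) _ _ (∙-cancelʳ b _ _ (ℤₚ.*-cancelˡ-≡ (+ a) _ _ eq))))))

-- If a x = c y then σ(x) ≤ σ(a x) = σ(c y) ≤ σ(c) σ(y).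
σ-proportional : ∀ {a c x y} → 0 < a → 0 < c → 0ℤ ℤ.< y → + a ℤ.* x ≡ + c ℤ.* y →
                 0ℤ ℤ.< x × σ ℤ.∣ x ∣ ≤ σ c * σ ℤ.∣ y ∣
σ-proportional {a@(suc _)} {c@(suc _)} {x} {y@(ℤ.+[1+ _ ])} a>0 c>0 y>0 ax≡cy = x>0 , (begin
  σ ℤ.∣ x ∣              ≤⟨ σ-mono-∣ {{cy≢0}} (subst (ℤ.∣ x ∣ ∣_) abs≡ (n∣m*n a)) ⟩
  σ (c * ℤ.∣ y ∣)        ≤⟨ σ-*-≤ c ℤ.∣ y ∣ ⟩
  σ c * σ ℤ.∣ y ∣        ∎)
  where
  open ≤-Reasoning
  cy≢0 : NonZero (c * ℤ.∣ y ∣)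
  cy≢0 = m*n≢0 c ℤ.∣ y ∣
  abs≡ : a * ℤ.∣ x ∣ ≡ c * ℤ.∣ y ∣
  abs≡ = trans (sym (ℤₚ.abs-* (+ a) x)) (trans (cong ℤ.∣_∣ ax≡cy) (ℤₚ.abs-* (+ c) y))
  x>0 : 0ℤ ℤ.< x
  x>0 = ℤₚ.*-cancelˡ-<-nonNeg (+ a) (subst₂ ℤ._<_ (sym (ℤₚ.*-zeroʳ (+ a))) (sym ax≡cy) (+<+ z<s))
σ-proportional {c = suc _} {y = + zero} _ _ (+<+ ())

module _ (a c : ℕ) (a>0 : 0 < a) (c>0 : 0 < c) (b d : ℤ) (k : ℕ) where

  -- At n + 1, ..., n + k the two forms are positive, and σ of the first is larger.
  Dominates : ℕ → Set
  Dominates n = ∀ i → 1 ≤ i → i ≤ k →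
    0ℤ ℤ.< affine a b (n + i) × 0ℤ ℤ.< affine c d (n + i) ×
    σ ℤ.∣ affine a b (n + i) ∣ > σ ℤ.∣ affine c d (n + i) ∣

  private instance
    a≢0 : NonZero a
    a≢0 = ℕ.>-nonZero a>0
    c≢0 : NonZero c
    c≢0 = ℕ.>-nonZero c>0

  -- The hypothesis says that c x + d is proportional to a (x + z) + b.
  module _ (z : ℤ) (dependent : + a ℤ.* d ≡ b ℤ.* + c ℤ.+ z ℤ.* (+ a ℤ.* + c)) where

    proportional : ∀ n → + a ℤ.* affine c d n ≡ + c ℤ.* (+ a ℤ.* (+ n ℤ.+ z) ℤ.+ b)
    proportional n = begin
      + a ℤ.* (+ c ℤ.* + n ℤ.+ d)                        ≡⟨ lem (+ a) (+ c) (+ n) d ⟩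
      + a ℤ.* d ℤ.+ + a ℤ.* (+ c ℤ.* + n)                ≡⟨ cong (ℤ._+ + a ℤ.* (+ c ℤ.* + n)) dependent ⟩
      b ℤ.* + c ℤ.+ z ℤ.* (+ a ℤ.* + c) ℤ.+ + a ℤ.* (+ c ℤ.* + n) ≡⟨ lem′ (+ a) (+ c) (+ n) b z ⟩
      + c ℤ.* (+ a ℤ.* (+ n ℤ.+ z) ℤ.+ b)                ∎
      where
      open ≡-Reasoning
      lem : ∀ a c n d → a ℤ.* (c ℤ.* n ℤ.+ d) ≡ a ℤ.* d ℤ.+ a ℤ.* (c ℤ.* n)
      lem = ℤ-Solver.solve-∀
      lem′ : ∀ a c n b z → b ℤ.* c ℤ.+ z ℤ.* (a ℤ.* c) ℤ.+ a ℤ.* (c ℤ.* n) ≡ c ℤ.* (a ℤ.* (n ℤ.+ z) ℤ.+ b)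
      lem′ = ℤ-Solver.solve-∀

    -- Written with a common origin, as values of a x + b′ at natural translates
    -- n + j, the form a x + b has at n + i the index j = u i, and the form
    -- a (x + z) + b has the index j = v i. It suffices to rank u i above v i.
    dominates-if : ∀ b′ (u v : ℕ → ℕ) {N} (rank : Fin N → ℕ) → (∀ i j → i ≢ j → rank i ≢ rank j) →
      (u<N : ∀ {i} → i ≤ k → u i < N) (v<N : ∀ {i} → i ≤ k → v i < N) →
      (∀ {i} (i≤k : i ≤ k) → rank (fromℕ< (v<N i≤k)) < rank (fromℕ< (u<N i≤k))) →
      (∀ n i → affine a b (n + i) ≡ affine a b′ (n + u i)) →
      (∀ n i → + a ℤ.* (+ (n + i) ℤ.+ z) ℤ.+ b ≡ affine a b′ (n + v i)) →
      PositiveLowerDensity Dominates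
    dominates-if b′ u v {N} rank rank-distinct u<N v<N v<u u≡ v≡ = PositiveLowerDensity-mono (RankedTranslates a b′ rank (σ c)) Dominates
      (λ {n} (pos , compare) i _ i≤k →
        let
          at : ∀ {j} (j<N : j < N) → toℕ (fromℕ< j<N) ≡ j
          at j<N = toℕ-fromℕ< j<N
          y>0 = subst (λ j → 0ℤ ℤ.< affine a b′ (n + j)) (at {v i} (v<N i≤k)) (pos (fromℕ< (v<N i≤k)))
          x>0 , σx≤ = σ-proportional a>0 c>0 y>0 (trans (proportional (n + i)) (cong (+ c ℤ.*_) (v≡ n i)))
          σy< = subst₂ (λ j j′ → σ c * σ ℤ.∣ affine a b′ (n + j) ∣ < σ ℤ.∣ affine a b′ (n + j′) ∣)
                  (at {v i} (v<N i≤k)) (at {u i} (u<N i≤k)) (compare (fromℕ< (u<N i≤k)) (fromℕ< (v<N i≤k)) (v<u i≤k))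
        in subst (0ℤ ℤ.<_) (sym (u≡ n i)) (subst (λ j → 0ℤ ℤ.< affine a b′ (n + j)) (at {u i} (u<N i≤k)) (pos (fromℕ< (u<N i≤k)))) ,
           x>0 ,
           ≤-<-trans σx≤ (subst (λ y → σ c * σ ℤ.∣ affine a b′ (n + v i) ∣ < σ ℤ.∣ y ∣) (sym (u≡ n i)) σy<))
      (ranked-translates a a>0 b′ rank rank-distinct (σ c))

  -- For z > 0 the values of σ are made to fall and for z < 0 to rise, by factors
  -- above σ c. For z < 0 the origin is moved by z, to keep the indices natural.
  dominates-dependent : ∀ z → z ≢ 0ℤ → + a ℤ.* d ≡ b ℤ.* + c ℤ.+ z ℤ.* (+ a ℤ.* + c) → PositiveLowerDensity Dominates
  dominates-dependent (+ zero) z≢0 _ = contradiction refl z≢0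
  dominates-dependent z@(ℤ.+[1+ s ]) _ dependent =
    dominates-if z dependent b (λ i → i) (_+ suc s) {N} (λ j → N ∸ toℕ j)
      (λ i j i≢j eq → i≢j (toℕ-injective (∸-cancelˡ-≡ (<⇒≤ (toℕ<n i)) (<⇒≤ (toℕ<n j)) eq)))
      (λ i≤k → s≤s (≤-trans i≤k (m≤m+n k (suc s)))) (λ i≤k → s≤s (+-monoˡ-≤ (suc s) i≤k))
      (λ {i} i≤k → ∸-monoʳ-< (subst₂ _<_ (sym (toℕ-fromℕ< _)) (sym (toℕ-fromℕ< _)) (m<m+n i z<s)) (<⇒≤ (toℕ<n (fromℕ< _))))
      (λ n i → refl)
      (λ n i → cong (λ x → + a ℤ.* x ℤ.+ b) (trans (sym (ℤₚ.pos-+ (n + i) (suc s))) (cong +_ (+-assoc n i (suc s)))))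
    where
    N : ℕ
    N = suc (k + suc s)
  dominates-dependent z@(-[1+ s ]) _ dependent =
    dominates-if z dependent (+ a ℤ.* z ℤ.+ b) (_+ suc s) (λ i → i) {N} toℕ
      (λ i j i≢j eq → i≢j (toℕ-injective eq))
      (λ i≤k → s≤s (+-monoˡ-≤ (suc s) i≤k)) (λ i≤k → s≤s (≤-trans i≤k (m≤m+n k (suc s))))
      (λ {i} i≤k → subst₂ _<_ (sym (toℕ-fromℕ< _)) (sym (toℕ-fromℕ< _)) (m<m+n i z<s))
      (λ n i → sym (trans (affine-shift a b z (n + (i + suc s))) (cong (λ x → + a ℤ.* x ℤ.+ b) (cancel n i))))
      (λ n i → sym (affine-shift a b z (n + i)))
    where
    N : ℕ
    N = suc (k + suc s)
    cancel : ∀ n i → + (n + (i + suc s)) ℤ.+ -[1+ s ] ≡ + (n + i)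
    cancel n i = begin
      + (n + (i + suc s)) ℤ.+ -[1+ s ]       ≡⟨ cong (λ m → + m ℤ.+ -[1+ s ]) (+-assoc n i (suc s)) ⟨
      + (n + i + suc s) ℤ.+ -[1+ s ]         ≡⟨ cong (ℤ._+ -[1+ s ]) (ℤₚ.pos-+ (n + i) (suc s)) ⟩
      + (n + i) ℤ.+ + suc s ℤ.+ -[1+ s ]     ≡⟨ lem (+ (n + i)) (+ suc s) ⟩
      + (n + i)                              ∎
      where
      open ≡-Reasoning
      lem : ∀ m s → m ℤ.+ s ℤ.+ ℤ.- s ≡ m
      lem = ℤ-Solver.solve-∀

  -- None of the forms a (n + i) + b is proportional to any of the c (n + j) + d, so
  -- all 2 k of them can be ranked, the former above the latter.
  dominates-independent : ¬ (+ a ℤ.* + c ℤ∣.∣ + a ℤ.* d ℤ.- b ℤ.* + c) → PositiveLowerDensity Dominates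
  dominates-independent ac∤ = PositiveLowerDensity-mono (Ranked (α ∘ splitAt k) (β ∘ splitAt k) (rank ∘ splitAt k) 1) Dominates dominates
    (ranked-σ (α ∘ splitAt k) (β ∘ splitAt k) (rank ∘ splitAt k) (α>0 ∘ splitAt k)
      (λ i j i≢j → rank-distinct _ _ (i≢j ∘ splitAt-injective i j))
      (λ i j i≢j → independent _ _ (i≢j ∘ splitAt-injective i j)) 1)
    where
    Index : Set
    Index = Fin k ⊎ Fin k
    α : Index → ℕ
    α = [ const a , const c ]′
    β : Index → ℤ
    β = [ (λ i → + a ℤ.* + suc (toℕ i) ℤ.+ b) , (λ i → + c ℤ.* + suc (toℕ i) ℤ.+ d) ]′
    rank : Index → ℕ
    rank = [ (λ i → k + toℕ i) , toℕ ]′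
    α>0 : ∀ x → 0 < α x
    α>0 (inj₁ _) = a>0
    α>0 (inj₂ _) = c>0
    splitAt-injective : ∀ i j → splitAt k {k} i ≡ splitAt k j → i ≡ j
    splitAt-injective i j eq = trans (sym (join-splitAt k k i)) (trans (cong (join k k) eq) (join-splitAt k k j))
    rank-distinct : ∀ x y → x ≢ y → rank x ≢ rank y
    rank-distinct (inj₁ i) (inj₁ j) x≢y eq = x≢y (cong inj₁ (toℕ-injective (+-cancelˡ-≡ k _ _ eq)))
    rank-distinct (inj₁ i) (inj₂ j) x≢y eq = <⇒≢ (<-≤-trans (toℕ<n j) (m≤m+n k (toℕ i))) (sym eq)
    rank-distinct (inj₂ i) (inj₁ j) x≢y eq = <⇒≢ (<-≤-trans (toℕ<n i) (m≤m+n k (toℕ j))) eq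
    rank-distinct (inj₂ i) (inj₂ j) x≢y eq = x≢y (cong inj₂ (toℕ-injective eq))
    same : ∀ a b i j .{{_ : NonZero a}} → + a ℤ.* (+ a ℤ.* + suc i ℤ.+ b) ≡ + a ℤ.* (+ a ℤ.* + suc j ℤ.+ b) → i ≡ j
    same a b i j eq = suc-injective (ℤₚ.+-injective (ℤₚ.*-cancelˡ-≡ (+ a) _ _ (∙-cancelʳ b _ _ (ℤₚ.*-cancelˡ-≡ (+ a) _ _ eq))))
    cross : ∀ i j → + a ℤ.* (+ c ℤ.* + suc j ℤ.+ d) ≢ + c ℤ.* (+ a ℤ.* + suc i ℤ.+ b)
    cross i j eq = ac∤ (ℤ∣.divides (+ suc i ℤ.- + suc j) (begin
      + a ℤ.* d ℤ.- b ℤ.* + c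
        ≡⟨ lem (+ a) (+ c) b d (+ suc i) (+ suc j) ⟩
      (+ suc i ℤ.- + suc j) ℤ.* (+ a ℤ.* + c) ℤ.+ (+ a ℤ.* (+ c ℤ.* + suc j ℤ.+ d) ℤ.- + c ℤ.* (+ a ℤ.* + suc i ℤ.+ b))
        ≡⟨ cong (λ w → (+ suc i ℤ.- + suc j) ℤ.* (+ a ℤ.* + c) ℤ.+ w) (ℤₚ.i≡j⇒i-j≡0 eq) ⟩
      (+ suc i ℤ.- + suc j) ℤ.* (+ a ℤ.* + c) ℤ.+ 0ℤ
        ≡⟨ ℤₚ.+-identityʳ _ ⟩
      (+ suc i ℤ.- + suc j) ℤ.* (+ a ℤ.* + c) ∎))
      where
      open ≡-Reasoning
      lem : ∀ a c b d i j → a ℤ.* d ℤ.- b ℤ.* c ≡ (i ℤ.- j) ℤ.* (a ℤ.* c) ℤ.+ (a ℤ.* (c ℤ.* j ℤ.+ d) ℤ.- c ℤ.* (a ℤ.* i ℤ.+ b))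
      lem = ℤ-Solver.solve-∀
    independent : ∀ x y → x ≢ y → + α x ℤ.* β y ≢ + α y ℤ.* β x
    independent (inj₁ i) (inj₁ j) x≢y eq = x≢y (cong inj₁ (toℕ-injective (sym (same a b (toℕ j) (toℕ i) eq))))
    independent (inj₁ i) (inj₂ j) _   eq = cross (toℕ i) (toℕ j) eq
    independent (inj₂ i) (inj₁ j) _   eq = cross (toℕ j) (toℕ i) (sym eq)
    independent (inj₂ i) (inj₂ j) x≢y eq = x≢y (cong inj₂ (toℕ-injective (sym (same c d (toℕ j) (toℕ i) eq))))
    dominates : ∀ {n} → Ranked (α ∘ splitAt k) (β ∘ splitAt k) (rank ∘ splitAt k) 1 n → Dominates n
    dominates {n} (pos , compare) (suc i) _ i<k =
      subst (0ℤ ℤ.<_) left≡ (pos (x ↑ˡ k)) ,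
      subst (0ℤ ℤ.<_) right≡ (pos (k ↑ʳ x)) ,
      subst₂ (λ y z → σ ℤ.∣ y ∣ < σ ℤ.∣ z ∣) right≡ left≡
        (subst (_< σ ℤ.∣ affine (α (splitAt k (x ↑ˡ k))) (β (splitAt k (x ↑ˡ k))) n ∣) (*-identityˡ (σ ℤ.∣ affine (α (splitAt k (k ↑ʳ x))) (β (splitAt k (k ↑ʳ x))) n ∣)) (compare (x ↑ˡ k) (k ↑ʳ x)
          (subst₂ (λ s t → rank s < rank t) (sym (splitAt-↑ʳ k k x)) (sym (splitAt-↑ˡ k x k)) (<-≤-trans (toℕ<n x) (m≤m+n k (toℕ x))))))
      where
      x : Fin k
      x = fromℕ< i<k
      value : ∀ a b → affine a (+ a ℤ.* + suc (toℕ x) ℤ.+ b) n ≡ affine a b (n + suc i)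
      value a b = trans (affine-shift a b (+ suc (toℕ x)) n)
        (cong (λ z → + a ℤ.* z ℤ.+ b) (trans (sym (ℤₚ.pos-+ n _)) (cong (λ i → + (n + suc i)) (toℕ-fromℕ< i<k))))
      left≡ : affine (α (splitAt k (x ↑ˡ k))) (β (splitAt k (x ↑ˡ k))) n ≡ affine a b (n + suc i)
      left≡ = trans (cong (λ s → affine (α s) (β s) n) (splitAt-↑ˡ k x k)) (value a b)
      right≡ : affine (α (splitAt k (k ↑ʳ x))) (β (splitAt k (k ↑ʳ x))) n ≡ affine c d (n + suc i)
      right≡ = trans (cong (λ s → affine (α s) (β s) n) (splitAt-↑ʳ k k x)) (value c d)

  dominates : + a ℤ.* d ≢ b ℤ.* + c → PositiveLowerDensity Dominates
  dominates ad≢bc with (+ a ℤ.* + c) ℤ∣.∣? (+ a ℤ.* d ℤ.- b ℤ.* + c)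
  ... | no  ac∤                 = dominates-independent ac∤
  ... | yes (ℤ∣.divides z eq) = dominates-dependent z
    (λ { refl → ad≢bc (ℤₚ.i-j≡0⇒i≡j _ _ eq) })
    (trans (lem (+ a ℤ.* d) (b ℤ.* + c)) (cong (λ w → b ℤ.* + c ℤ.+ w) eq))
    where
    lem : ∀ x y → x ≡ y ℤ.+ (x ℤ.- y)
    lem = ℤ-Solver.solve-∀

-- The three statements

corollary4 : (∀ (k : ℕ) → 2 ≤ k →
    ∀ (a : Fin k → ℕ) → (∀ i → 0 < a i) →
    ∀ (b : Fin k → ℤ) →
    (∀ i j → i <ᶠ j → + a i ℤ.* b j ≢ + a j ℤ.* b i) →
    (∀ (C : ℝ) → 0ℚ ℚ<ℝ C →
    PositiveLowerDensity (λ n →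
    Σ[ pos ∈ (∀ i → 0ℤ ℤ.< affine (a i) (b i) n) ]
    (∀ i j → toℕ j ≡ suc (toℕ i) → C <ℝℚ σ-ratio (pos i) (pos j))))
    ×
    PositiveLowerDensity (λ n →
    (∀ i → 0ℤ ℤ.< affine (a i) (b i) n) ×
    (∀ i j → toℕ j ≡ suc (toℕ i) →
    σ ℤ.∣ affine (a i) (b i) n ∣ > σ ℤ.∣ affine (a j) (b j) n ∣)))
    ×
    (∀ (k : ℕ) → 2 ≤ k →
    ∀ (ε : Fin (k ∸ 1) → ℤ) → (∀ i → ε i ≡ -1ℤ ⊎ ε i ≡ 1ℤ) →
    PositiveLowerDensity (λ n →
    ∀ i → ε i ℤ.* (+ σ (n + (toℕ i + 1)) ℤ.- + σ (n + (toℕ i + 2))) ℤ.> 0ℤ))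
    ×
    (∀ (a c : ℕ) → 0 < a → 0 < c →
    ∀ (b d : ℤ) → + a ℤ.* d ≢ b ℤ.* + c →
    ∀ (k : ℕ) → 0 < k →
    PositiveLowerDensity (λ n →
    ∀ i → 1 ≤ i → i ≤ k →
    0ℤ ℤ.< affine a b (n + i) ×
    0ℤ ℤ.< affine c d (n + i) ×
    σ ℤ.∣ affine a b (n + i) ∣ > σ ℤ.∣ affine c d (n + i) ∣))
corollary4 =
  (λ k _ a a>0 b independent →
    (λ C _ → descending-σ-ratio a a>0 b independent C) ,
    descending-σ-strictly a a>0 b independent) ,
  (λ k _ ε ε=±1 → prescribed-signs ε ε=±1) ,
  (λ a c a>0 c>0 b d ad≢bc k _ → dominates a c a>0 c>0 b d k ad≢bc)
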